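{- Knowledge embedding is a simulation for the reduction relation $\to$: for all processes $P,P',Q$, if $P\to Q$ and $P\sqsubseteq P'$, then there is a process $Q'$ such that $P'\to Q'$ and $Q\sqsubseteq Q'$.
   Context: Fix an effective intruder model $(\Sigma,\vdash)$: messages are terms over a countably infinite set of names and the finite constructor signature $\Sigma$; $\vdash$ is a decidable relation between finite sets of messages and messages satisfying: $\{M\}\vdash M$; $\Gamma\subseteq\Gamma'$ and $\Gamma\vdash M$ imply $\Gamma'\vdash M$; $\Gamma\vdash M$ and $\Gamma\cup\{M\}\vdash N$ imply $\Gamma\vdash N$; $\{M_1,\dots,M_n\}\vdash f(M_1,\dots,M_n)$ for each constructor $f$ of arity $n$; $\Gamma\theta\vdash M\theta$ iff $\Gamma\vdash M$ for each injective renaming $\theta$ of the names of $\Gamma$ into names; and $\Gamma\cup\{a\}\vdash M$ with $a$ a name not occurring in $\Gamma,M$ implies $\Gamma\vdash M$. $\Gamma_1\preceq\Gamma_2$ iff every $M$ with $\Gamma_1\vdash M$ has $\Gamma_2\vdash M$; $\Gamma_1\simeq\Gamma_2$ iff both directions hold. Processes and actions (over a finite set of process identifiers $\mathsf Q$ with arities): $P::=0\mid\nu x.P\mid P\parallel P\mid\langle M\rangle\mid\mathsf Q[M_1,\dots,M_n]$ and $A::=\overline c\langle M\rangle.P\mid c(\vec x:M).P\mid A+A$, where $c$ is a name (channel), $\langle M\rangle$ means $M$ is known to the intruder, $\vec x$ are pairwise distinct names bound in the continuation $P$ (pattern $\vec x:M$), and $\nu x$ binds $x$. $\langle\Gamma\rangle$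 is the parallel composition of $\langle M\rangle$ for $M\in\Gamma$. A fixed finite set $\Delta$ of definitions $\mathsf Q[x_1,\dots,x_n]:=A$ (at most one per identifier, free names of $A$ among the $x_i$) is given; write $\mathsf Q[\vec M]\triangleq A$ if $\mathsf Q[\vec x]:=A'\in\Delta$ and $A$ is $\alpha$-equivalent to $A'\{\vec x\mapsto\vec M\}$ up to associativity and commutativity of $+$. Structural congruence $\equiv$: smallest congruence containing $\alpha$-equivalence, with $\parallel$ and $+$ associative and commutative, $0$ neutral for $\parallel$, $\nu a.0\equiv0$, $\nu a.\nu b.P\equiv\nu b.\nu a.P$, $P\parallel\nu a.Q\equiv\nu a.(P\parallel Q)$ if $a$ not free in $P$. Knowledge congruence $\cong$: smallest congruence containing $\equiv$ with $\langle\Gamma_1\rangle\cong\langle\Gamma_2\rangle$ whenever $\Gamma_1\simeq\Gamma_2$. Knowledge embedding: $P_1\sqsubseteq P_2$ iff $P_1\equiv\nu\vec x.(\langle\Gamma_1\rangle\parallel Q)$ and $P_2\equiv\nu\vec x.\nu\vec y.(\langle\Gamma_2\rangle\parallel Q\parallel Q')$ for some $\vec x,\vec y,\Gamma_1,\Gamma_2,Q,Q'$ with $\Gamma_1\preceq\Gamma_2$. The reduction relation $\to$ is the smallest relation such that: (Comm) if $\mathsf Q_1[\vec M_1]\triangleq\overline c\langle N\{\vec x\mapsto\vec M'\}\rangle.P_1+A_1$ and $\mathsf Q_2[\vec M_2]\triangleq c(\vec x:N).P_2+A_2$ then $\nu\vec a.(\langle\Gamma\rangle\parallel\mathsf Q_1[\vec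 M_1]\parallel\mathsf Q_2[\vec M_2]\parallel C)\to\nu\vec a.(\langle\Gamma\rangle\parallel P_1\parallel P_2\{\vec x\mapsto\vec M'\}\parallel C)$; (PubOut) if $\mathsf Q[\vec M]\triangleq\overline c\langle M\rangle.P+A$ and $\Gamma\vdash c$ then $\nu\vec a.(\langle\Gamma\rangle\parallel\mathsf Q[\vec M]\parallel C)\to\nu\vec a.(\langle\Gamma\rangle\parallel\langle M\rangle\parallel P\parallel C)$; (PubIn) if $\mathsf Q[\vec M]\triangleq c(\vec x:N).P+A$, $\Gamma\vdash c$, $\vec y$ are fresh names and $\Gamma\cup\vec y\vdash N\{\vec x\mapsto\vec M'\}$ then $\nu\vec a.(\langle\Gamma\rangle\parallel\mathsf Q[\vec M]\parallel C)\to\nu\vec a.\nu\vec y.(\langle\Gamma\rangle\parallel\langle\vec y\rangle\parallel P\{\vec x\mapsto\vec M'\}\parallel C)$; and (closure) if $P\cong P'\to Q'\cong Q$ then $P\to Q$. -}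

module Defs where

open import Data.Nat using (ℕ; _≡ᵇ_)
open import Data.Bool using (Bool; true; false; if_then_else_; not; _∨_)
open import Data.Fin using (Fin)
open import Data.Vec as Vec using (Vec; []; _∷_)
open import Data.List as List using (List; []; _∷_; _++_; filterᵇ; foldr; concatMap; length)
open import Data.List.Membership.Propositional using (_∈_; _∉_)
open import Data.List.Relation.Binary.Subset.Propositional using (_⊆_)
open import Data.List.Relation.Unary.Unique.Propositional using (Unique)
open import Data.List.Relation.Unary.All using (All)
open import Data.Maybe using (Maybe; just; nothing)
open import Data.Product using (Σ; Σ-syntax; _×_; _,_; proj₁; proj₂)
open import Data.Unit using (⊤)
open import Relation.Binary.PropositionalEquality using (_≡_)
open import Relation.Nullary using (Dec)
open import Function using (_⇔_; _∘_)
open import Function.Definitions using (Injective)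

-- Names are natural numbers (a countably infinite set).
-- The finite constructor signature Σ is given by k constructors
-- (Fin k) with arities ar.

module Syntax (k : ℕ) (ar : Fin k → ℕ) where

  Name : Set
  Name = ℕ

  data Msg : Set where
    name : Name → Msg
    app  : (f : Fin k) → Vec Msg (ar f) → Msg

  mutual
    names : Msg → List Name
    names (name a)   = a ∷ []
    names (app f Ms) = namesV Ms

    namesV : ∀ {n} → Vec Msg n → List Name
    namesV []       = []
    namesV (M ∷ Ms) = names M ++ namesV Ms

  namesL : List Msg → List Name
  namesL = concatMap names

  mutual
    rename : (Name → Name) → Msg → Msg
    rename θ (name a)   = name (θ a)
    rename θ (app f Ms) = app f (renameV θ Ms)

    renameV : ∀ {n} → (Name → Name) → Vec Msg n → Vec Msg n
    renameV θ []       = []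
    renameV θ (M ∷ Ms) = rename θ M ∷ renameV θ Ms

  Subst : Set
  Subst = List (Name × Msg)

  lookupσ : Subst → Name → Maybe Msg
  lookupσ []            a = nothing
  lookupσ ((b , M) ∷ σ) a = if a ≡ᵇ b then just M else lookupσ σ a

  mutual
    substM : Subst → Msg → Msg
    substM σ (name a) with lookupσ σ a
    ... | just M  = M
    ... | nothing = name a
    substM σ (app f Ms) = app f (substV σ Ms)

    substV : ∀ {n} → Subst → Vec Msg n → Vec Msg n
    substV σ []       = []
    substV σ (M ∷ Ms) = substM σ M ∷ substV σ Ms

  zipσ : ∀ {n} → Vec Name n → Vec Msg n → Subst
  zipσ xs Ms = Vec.toList (Vec.zip xs Ms)

  memᵇ : Name → List Name → Bool
  memᵇ y []       = false
  memᵇ y (x ∷ xs) = (y ≡ᵇ x) ∨ memᵇ y xs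

  remove : List Name → List Name → List Name
  remove xs = filterᵇ (λ y → not (memᵇ y xs))

  removeσ : List Name → Subst → Subst
  removeσ xs = filterᵇ (λ p → not (memᵇ (proj₁ p) xs))

  rangeσ : Subst → List Name
  rangeσ = concatMap (names ∘ proj₂)

  -- Effective intruder model  (Σ , ⊢);  finite sets of messages are
  -- represented by lists (membership/order/duplicates are irrelevant
  -- by monotonicity).

  record IntruderModel : Set₁ where
    field
      _⊢_      : List Msg → Msg → Set
      ⊢-dec    : ∀ Γ M → Dec (Γ ⊢ M)
      ⊢-ax     : ∀ M → (M ∷ []) ⊢ M
      ⊢-mono   : ∀ {Γ Γ' M} → Γ ⊆ Γ' → Γ ⊢ M → Γ' ⊢ M
      ⊢-cut    : ∀ {Γ M N} → Γ ⊢ M → (M ∷ Γ) ⊢ N → Γ ⊢ N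
      ⊢-con    : ∀ (f : Fin k) (Ms : Vec Msg (ar f)) → Vec.toList Ms ⊢ app f Ms
      ⊢-ren    : ∀ (θ : Name → Name) → Injective _≡_ _≡_ θ → ∀ Γ M →
                   (List.map (rename θ) Γ ⊢ rename θ M) ⇔ (Γ ⊢ M)
      ⊢-fresh  : ∀ {Γ M a} → a ∉ namesL Γ → a ∉ names M → (name a ∷ Γ) ⊢ M → Γ ⊢ M

  module Processes (nq : ℕ) (qar : Fin nq → ℕ) where

    infixr 5 _∥_
    infixr 4 _⊕_

    data Proc : Set where
      𝟘    : Proc
      ν    : Name → Proc → Proc
      _∥_  : Proc → Proc → Proc
      ⟪_⟫  : Msg → Proc
      call : (q : Fin nq) → Vec Msg (qar q) → Proc

    data Act : Set where
      out : Name → Msg → Proc → Act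
      inp : Name → List Name → Msg → Proc → Act
      _⊕_ : Act → Act → Act

    WFA : Act → Set
    WFA (out c M P)    = ⊤
    WFA (inp c xs M P) = Unique xs
    WFA (A ⊕ B)        = WFA A × WFA B

    fnP : Proc → List Name
    fnP 𝟘           = []
    fnP (ν x P)     = remove (x ∷ []) (fnP P)
    fnP (P ∥ Q)     = fnP P ++ fnP Q
    fnP ⟪ M ⟫       = names M
    fnP (call q Ms) = namesV Ms

    fnA : Act → List Name
    fnA (out c M P)    = c ∷ names M ++ fnP P
    fnA (inp c xs M P) = c ∷ remove xs (names M ++ fnP P)
    fnA (A ⊕ B)        = fnA A ++ fnA B

    allP : Proc → List Name
    allP 𝟘           = []
    allP (ν x P)     = x ∷ allP P
    allP (P ∥ Q)     = allP P ++ allP Q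
    allP ⟪ M ⟫       = names M
    allP (call q Ms) = namesV Ms

    allA : Act → List Name
    allA (out c M P)    = c ∷ names M ++ allP P
    allA (inp c xs M P) = c ∷ xs ++ names M ++ allP P
    allA (A ⊕ B)        = allA A ++ allA B

    sw : Name → Name → Name → Name
    sw a b n = if n ≡ᵇ a then b else (if n ≡ᵇ b then a else n)

    swapM : Name → Name → Msg → Msg
    swapM a b = rename (sw a b)

    swapP : Name → Name → Proc → Proc
    swapP a b 𝟘           = 𝟘
    swapP a b (ν x P)     = ν (sw a b x) (swapP a b P)
    swapP a b (P ∥ Q)     = swapP a b P ∥ swapP a b Q
    swapP a b ⟪ M ⟫       = ⟪ swapM a b M ⟫
    swapP a b (call q Ms) = call q (renameV (sw a b) Ms)

    swapsM : List Name → List Name → Msg → Msg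
    swapsM (x ∷ xs) (z ∷ zs) M = swapsM xs zs (swapM x z M)
    swapsM _        _        M = M

    swapsP : List Name → List Name → Proc → Proc
    swapsP (x ∷ xs) (z ∷ zs) P = swapsP xs zs (swapP x z P)
    swapsP _        _        P = P

    data _=α_ : Proc → Proc → Set where
      α-𝟘    : 𝟘 =α 𝟘
      α-ν    : ∀ {x y P Q} (z : Name) → z ∉ allP (ν x P) → z ∉ allP (ν y Q) →
               swapP x z P =α swapP y z Q → ν x P =α ν y Q
      α-∥    : ∀ {P P' Q Q'} → P =α P' → Q =α Q' → (P ∥ Q) =α (P' ∥ Q')
      α-⟪⟫   : ∀ {M} → ⟪ M ⟫ =α ⟪ M ⟫
      α-call : ∀ {q Ms} → call q Ms =α call q Ms

    data _=αA_ : Act → Act → Set where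
      αA-out : ∀ {c N P P'} → P =α P' → out c N P =αA out c N P'
      αA-inp : ∀ {c xs ys N N' P P'} (zs : List Name) → Unique zs →
               length zs ≡ length xs → length zs ≡ length ys →
               All (_∉ allA (inp c xs N P)) zs → All (_∉ allA (inp c ys N' P')) zs →
               swapsM xs zs N ≡ swapsM ys zs N' →
               swapsP xs zs P =α swapsP ys zs P' →
               inp c xs N P =αA inp c ys N' P'
      αA-⊕   : ∀ {A A' B B'} → A =αA A' → B =αA B' → (A ⊕ B) =αA (A' ⊕ B')

    data _≈A_ : Act → Act → Set where
      ≈-α     : ∀ {A B} → A =αA B → A ≈A B
      ≈-refl  : ∀ {A} → A ≈A A
      ≈-sym   : ∀ {A B} → A ≈A B → B ≈A A
      ≈-trans : ∀ {A B C} → A ≈A B → B ≈A C → A ≈A C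
      ≈-assoc : ∀ {A B C} → ((A ⊕ B) ⊕ C) ≈A (A ⊕ (B ⊕ C))
      ≈-comm  : ∀ {A B} → (A ⊕ B) ≈A (B ⊕ A)
      ≈-⊕     : ∀ {A A' B B'} → A ≈A A' → B ≈A B' → (A ⊕ B) ≈A (A' ⊕ B')

    -- naive substitution, defined only when no capture occurs
    -- (binders avoid all names of the range of σ); channels must be
    -- mapped to names.
    data SubP : Subst → Proc → Proc → Set where
      s-𝟘    : ∀ {σ} → SubP σ 𝟘 𝟘
      s-ν    : ∀ {σ x P P'} → x ∉ rangeσ σ → SubP (removeσ (x ∷ []) σ) P P' →
               SubP σ (ν x P) (ν x P')
      s-∥    : ∀ {σ P P' Q Q'} → SubP σ P P' → SubP σ Q Q' → SubP σ (P ∥ Q) (P' ∥ Q')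
      s-⟪⟫   : ∀ {σ M} → SubP σ ⟪ M ⟫ ⟪ substM σ M ⟫
      s-call : ∀ {σ q Ms} → SubP σ (call q Ms) (call q (substV σ Ms))

    data SubA : Subst → Act → Act → Set where
      s-out : ∀ {σ c d N P P'} → substM σ (name c) ≡ name d → SubP σ P P' →
              SubA σ (out c N P) (out d (substM σ N) P')
      s-inp : ∀ {σ c d xs N P P'} → substM σ (name c) ≡ name d →
              All (_∉ rangeσ σ) xs → SubP (removeσ xs σ) P P' →
              SubA σ (inp c xs N P) (inp d xs (substM (removeσ xs σ) N) P')
      s-⊕   : ∀ {σ A A' B B'} → SubA σ A A' → SubA σ B B' → SubA σ (A ⊕ B) (A' ⊕ B')

    -- capture-avoiding substitution  P σ = R  (up to α-renaming of P)
    _[_]≔_ : Proc → Subst → Proc → Set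
    P [ σ ]≔ R = Σ[ P₀ ∈ Proc ] (P =α P₀ × SubP σ P₀ R)

    record Def (n : ℕ) : Set where
      field
        params          : Vec Name n
        params-distinct : Unique (Vec.toList params)
        body            : Act
        body-wf         : WFA body
        body-closed     : fnA body ⊆ Vec.toList params

    Definitions : Set
    Definitions = (q : Fin nq) → Maybe (Def (qar q))

    nus : List Name → Proc → Proc
    nus xs P = foldr ν P xs

    ⟨_⟩ : List Msg → Proc
    ⟨ Γ ⟩ = foldr (λ M P → ⟪ M ⟫ ∥ P) 𝟘 Γ

    data _≡ₛ_ : Proc → Proc → Set where
      ≡-α      : ∀ {P Q} → P =α Q → P ≡ₛ Q
      ≡-refl   : ∀ {P} → P ≡ₛ P
      ≡-sym    : ∀ {P Q} → P ≡ₛ Q → Q ≡ₛ P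
      ≡-trans  : ∀ {P Q R} → P ≡ₛ Q → Q ≡ₛ R → P ≡ₛ R
      ≡-ν      : ∀ {x P Q} → P ≡ₛ Q → ν x P ≡ₛ ν x Q
      ≡-∥      : ∀ {P P' Q Q'} → P ≡ₛ P' → Q ≡ₛ Q' → (P ∥ Q) ≡ₛ (P' ∥ Q')
      ≡-assoc  : ∀ {P Q R} → ((P ∥ Q) ∥ R) ≡ₛ (P ∥ (Q ∥ R))
      ≡-comm   : ∀ {P Q} → (P ∥ Q) ≡ₛ (Q ∥ P)
      ≡-unit   : ∀ {P} → (P ∥ 𝟘) ≡ₛ P
      ≡-ν𝟘     : ∀ {a} → ν a 𝟘 ≡ₛ 𝟘
      ≡-νν     : ∀ {a b P} → ν a (ν b P) ≡ₛ ν b (ν a P)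
      ≡-extr   : ∀ {a P Q} → a ∉ fnP P → (P ∥ ν a Q) ≡ₛ ν a (P ∥ Q)

    module Semantics (IM : IntruderModel) (Δ : Definitions) where

      open IntruderModel IM

      _⪯_ : List Msg → List Msg → Set
      Γ₁ ⪯ Γ₂ = ∀ M → Γ₁ ⊢ M → Γ₂ ⊢ M

      _≃_ : List Msg → List Msg → Set
      Γ₁ ≃ Γ₂ = Γ₁ ⪯ Γ₂ × Γ₂ ⪯ Γ₁

      data _≅_ : Proc → Proc → Set where
        ≅-≡     : ∀ {P Q} → P ≡ₛ Q → P ≅ Q
        ≅-know  : ∀ {Γ₁ Γ₂} → Γ₁ ≃ Γ₂ → ⟨ Γ₁ ⟩ ≅ ⟨ Γ₂ ⟩
        ≅-refl  : ∀ {P} → P ≅ P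
        ≅-sym   : ∀ {P Q} → P ≅ Q → Q ≅ P
        ≅-trans : ∀ {P Q R} → P ≅ Q → Q ≅ R → P ≅ R
        ≅-ν     : ∀ {x P Q} → P ≅ Q → ν x P ≅ ν x Q
        ≅-∥     : ∀ {P P' Q Q'} → P ≅ P' → Q ≅ Q' → (P ∥ Q) ≅ (P' ∥ Q')

      _⊑_ : Proc → Proc → Set
      P₁ ⊑ P₂ = Σ[ xs ∈ List Name ] Σ[ ys ∈ List Name ] Σ[ Γ₁ ∈ List Msg ]
                Σ[ Γ₂ ∈ List Msg ] Σ[ Q ∈ Proc ] Σ[ Q' ∈ Proc ]
                  ( P₁ ≡ₛ nus xs (⟨ Γ₁ ⟩ ∥ Q)
                  × P₂ ≡ₛ nus xs (nus ys (⟨ Γ₂ ⟩ ∥ Q ∥ Q'))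
                  × Γ₁ ⪯ Γ₂ )

      _[_]≜_ : (q : Fin nq) → Vec Msg (qar q) → Act → Set
      q [ Ms ]≜ A = Σ[ d ∈ Def (qar q) ] (Δ q ≡ just d ×
                    Σ[ A₀ ∈ Act ] Σ[ A₁ ∈ Act ]
                      ( Def.body d =αA A₀
                      × SubA (zipσ (Def.params d) Ms) A₀ A₁
                      × A ≈A A₁ ))

      _⊕?_ : Act → Maybe Act → Act
      a ⊕? nothing  = a
      a ⊕? just B   = a ⊕ B

      data _⟶_ : Proc → Proc → Set where
        comm   : ∀ {as Γ q₁ Ms₁ q₂ Ms₂ C c xs N P₁ P₂ P₂' A₁ A₂}
                   (M's : Vec Msg (length xs)) →
                 q₁ [ Ms₁ ]≜ (out c (substM (zipσ (Vec.fromList xs) M's) N) P₁ ⊕? A₁) →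
                 q₂ [ Ms₂ ]≜ (inp c xs N P₂ ⊕? A₂) →
                 P₂ [ zipσ (Vec.fromList xs) M's ]≔ P₂' →
                 nus as (⟨ Γ ⟩ ∥ call q₁ Ms₁ ∥ call q₂ Ms₂ ∥ C)
                   ⟶ nus as (⟨ Γ ⟩ ∥ P₁ ∥ P₂' ∥ C)
        pubOut : ∀ {as Γ q Ms C c M P A} →
                 q [ Ms ]≜ (out c M P ⊕? A) →
                 Γ ⊢ name c →
                 nus as (⟨ Γ ⟩ ∥ call q Ms ∥ C)
                   ⟶ nus as (⟨ Γ ⟩ ∥ ⟪ M ⟫ ∥ P ∥ C)
        pubIn  : ∀ {as Γ q Ms C c xs N P P' A} (ys : List Name)
                   (M's : Vec Msg (length xs)) →
                 q [ Ms ]≜ (inp c xs N P ⊕? A) →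
                 Γ ⊢ name c →
                 Unique ys →
                 All (λ y → y ∉ as × y ∉ fnP (⟨ Γ ⟩ ∥ call q Ms ∥ C)) ys →
                 (Γ ++ List.map name ys) ⊢ substM (zipσ (Vec.fromList xs) M's) N →
                 P [ zipσ (Vec.fromList xs) M's ]≔ P' →
                 nus as (⟨ Γ ⟩ ∥ call q Ms ∥ C)
                   ⟶ nus as (nus ys (⟨ Γ ⟩ ∥ ⟨ List.map name ys ⟩ ∥ P' ∥ C))
        closure : ∀ {P P' Q Q'} → P ≅ P' → P' ⟶ Q' → Q' ≅ Q → P ⟶ Q

{-# OPTIONS --safe #-}
module Submission where

-- Since Γ₁ ⪯ Γ₂ gives Γ₂ ≃ Γ₁ ∪ Γ₂, the embedding P ⊑ P' means P ≡ νx⃗.R and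
-- P' ≅ νx⃗.νy⃗.(R ∥ S), and the task is to replay under νx⃗, next to S, a redex that is
-- only known to occur in some P₀ ≅ νx⃗.R.  Replace the restricted names of a process by
-- fresh ones and drop the restrictions: any such opening of νx⃗.R is matched by an opening
-- of P₀ with the same fresh names, the two differing only by the monoid laws of ∥ and by
-- equivalent knowledge.  So the redex appears, renamed, in the opening of R itself; as
-- reductions are invariant under injective renamings, it fires in P'.  The reduct is
-- compared with Q by opening both once more: split into messages and calls, the openings
-- have congruent calls and equivalent knowledge, which is exactly an instance of ⊑.
-- Invariance under renaming is delicate because an instance of a definition is only
-- given up to capture-avoiding substitution; it follows from a canonical choice of bound
-- names, for which α-equivalence is equality.

open import Defs
open import Data.Bool using (true; false; if_then_else_; not; T)
open import Data.Fin using (Fin)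
open import Data.List as List using (List; []; _∷_; _++_; length)
open import Data.List.Membership.Propositional using (_∈_; _∉_)
open import Data.List.Membership.Propositional.Properties using (∈-++⁺ˡ; ∈-++⁺ʳ; ∈-++⁻; ∈-map⁺; ∈-map⁻)
open import Data.List.Properties using (length-map; ++-assoc; ++-identityʳ; map-++; map-cong-local)
open import Data.List.Relation.Binary.Permutation.Propositional as ↭ using (_↭_; ↭-refl; ↭-reflexive; ↭-sym; ↭-trans; ↭⇒↭ₛ)
open import Data.List.Relation.Binary.Permutation.Propositional.Properties using (∈-resp-↭; ++-comm; ++-commutativeMonoid; ++⁺ˡ; ++⁺ʳ; shift; shifts) renaming (++-assoc to ↭-assoc)
open import Data.List.Relation.Binary.Subset.Propositional using (_⊆_)
open import Data.List.Relation.Unary.All as All using (All; []; _∷_)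
open import Data.List.Relation.Unary.AllPairs using ([]; _∷_)
open import Data.List.Relation.Unary.Any using (here; there)
open import Data.List.Relation.Unary.Unique.Propositional using (Unique)
open import Data.List.Relation.Unary.Unique.Propositional.Properties using (map⁺)
open import Data.Maybe as Maybe using (Maybe; just; nothing)
open import Data.Nat using (ℕ; zero; suc; _+_; _≤_; _<_; _≡ᵇ_; s≤s)
open import Data.Nat.Properties using (_≟_; ≡ᵇ⇒≡; ≤-refl; ≤-trans; <-irrefl; <⇒≢; n<1+n; m≤m+n; m≤n+m; +-suc; m<n⇒m<1+n; suc-injective; +-cancelˡ-≡)
open import Data.Product using (Σ-syntax; ∃; _×_; _,_; proj₁; proj₂)
open import Data.Sum using (_⊎_; inj₁; inj₂; [_,_]′)
open import Data.Unit using (tt)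
open import Data.Vec as Vec using (Vec; []; _∷_)
open import Function using (_∘_; id; const; Equivalence)
open import Function.Definitions using (Injective)
open import Relation.Binary.PropositionalEquality using (_≡_; _≢_; refl; sym; trans; cong; cong₂; subst; subst₂; setoid; module ≡-Reasoning)
open import Relation.Nullary using (yes; no; contradiction)

open import Data.List.Membership.DecPropositional _≟_ using (_∈?_)

open import Algebra.Solver.CommutativeMonoid (++-commutativeMonoid {A = ℕ}) using (solve; _⊜_) renaming (_⊕_ to _⊞_)
open import Data.List.Relation.Binary.Permutation.Setoid.Properties (setoid ℕ) using (Unique-resp-↭)

-- The obstacle is that `≅` is closed under symmetry and transitivity: a derivation between the
-- redex and `nus xs R` may create, drop and exchange restrictions at will, so the restrictions at
-- its two ends need not correspond. On openings, α-conversion and the scope laws leave the opened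
-- process unchanged, and only `ν a 𝟘 ≡ₛ 𝟘`, read from right to left, asks for a name that was not
-- there. The number of extra names therefore depends on the derivation alone. This is why all fresh
-- names can be drawn in advance from one block above every name in sight, and why one freshness
-- hypothesis serves the derivations on both sides of the reduction. As to instances of definitions,
-- `=α` has no transitivity rule and substitution is a relation that fails on capture; moreover,
-- renaming the derivation of an instance would also rename the parameters of the definition.
-- Canonical forms reduce these matters to equations between environments.

≡ᵇ-refl : ∀ a → (a ≡ᵇ a) ≡ true
≡ᵇ-refl zero    = refl
≡ᵇ-refl (suc a) = ≡ᵇ-refl a

≢⇒≡ᵇ-false : ∀ {a b} → a ≢ b → (a ≡ᵇ b) ≡ false
≢⇒≡ᵇ-false {a} {b} a≢b with a ≡ᵇ b in eq
... | false = refl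
... | true  = contradiction (≡ᵇ⇒≡ a b (subst T (sym eq) tt)) a≢b

-- Bounds and blocks of fresh names

bound : List ℕ → ℕ
bound []       = 0
bound (a ∷ as) = suc (a + bound as)

∈⇒<bound : ∀ {a as} → a ∈ as → a < bound as
∈⇒<bound {as = a ∷ as} (here refl) = s≤s (m≤m+n a (bound as))
∈⇒<bound {as = b ∷ as} (there p)   = m<n⇒m<1+n (≤-trans (∈⇒<bound p) (m≤n+m _ b))

block : ℕ → ℕ → List ℕ
block n zero    = []
block n (suc k) = n ∷ block (suc n) k

length-block : ∀ n k → length (block n k) ≡ k
length-block n zero    = refl
length-block n (suc k) = cong suc (length-block (suc n) k)

∈-block⇒≤ : ∀ {a} n k → a ∈ block n k → n ≤ a
∈-block⇒≤ n (suc k) (here refl) = ≤-refl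
∈-block⇒≤ n (suc k) (there p)   = ≤-trans (m≤n+m n 1) (∈-block⇒≤ (suc n) k p)

∈-block⇒< : ∀ {a} n k → a ∈ block n k → a < k + n
∈-block⇒< n (suc k) (here refl) = s≤s (m≤n+m n k)
∈-block⇒< {a} n (suc k) (there p) = subst (a <_) (+-suc k n) (∈-block⇒< (suc n) k p)

block-unique : ∀ n k → Unique (block n k)
block-unique n zero    = []
block-unique n (suc k) = All.tabulate (λ p → <⇒≢ (∈-block⇒≤ (suc n) k p)) ∷ block-unique (suc n) k

unique-disjoint : ∀ {A : Set} (xs : List A) {ys a} → Unique (xs ++ ys) → a ∈ xs → a ∉ ys
unique-disjoint (x ∷ xs) (x∉ ∷ u) (here refl) q = All.lookup x∉ (∈-++⁺ʳ xs q) refl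
unique-disjoint (x ∷ xs) (x∉ ∷ u) (there p)   q = unique-disjoint xs u p q

↭-interchange : ∀ {A : Set} (as bs cs ds : List A) → (as ++ bs) ++ (cs ++ ds) ↭ (as ++ cs) ++ (bs ++ ds)
↭-interchange as bs cs ds = ↭-trans (↭-assoc as bs (cs ++ ds))
  (↭-trans (++⁺ˡ as (shifts bs cs)) (↭-sym (↭-assoc as cs (bs ++ ds))))

-- Injectivity on finite sets and finite updates

InjOn : List ℕ → (ℕ → ℕ) → Set
InjOn L f = ∀ {a b} → a ∈ L → b ∈ L → f a ≡ f b → a ≡ b

-- Off L the extension takes values above all those on L.
extend : ∀ L ρ → InjOn L ρ → Σ[ π ∈ (ℕ → ℕ) ] (Injective _≡_ _≡_ π × (∀ {a} → a ∈ L → π a ≡ ρ a))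
extend L ρ i = π , π-injective , π-∈
  where
  B = bound (List.map ρ L)
  π : ℕ → ℕ
  π a with a ∈? L
  ... | yes _ = ρ a
  ... | no _  = B + a
  π-∈ : ∀ {a} → a ∈ L → π a ≡ ρ a
  π-∈ {a} p with a ∈? L
  ... | yes _ = refl
  ... | no ¬p = contradiction p ¬p
  small : ∀ {a} b → a ∈ L → ρ a ≢ B + b
  small {a} b p e = <-irrefl e (≤-trans (∈⇒<bound (∈-map⁺ ρ p)) (m≤m+n B b))
  π-injective : Injective _≡_ _≡_ π
  π-injective {a} {b} e with a ∈? L | b ∈? L
  ... | yes p | yes q = i p q e
  ... | yes p | no _  = contradiction e (small b p)
  ... | no _  | yes q = contradiction (sym e) (small a q)
  ... | no _  | no _  = +-cancelˡ-≡ B a b e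

upd : {V : Set} → (ℕ → V) → ℕ → V → ℕ → V
upd ρ x v a = if a ≡ᵇ x then v else ρ a

upd-same : ∀ {V : Set} (ρ : ℕ → V) x v → upd ρ x v x ≡ v
upd-same ρ x v rewrite ≡ᵇ-refl x = refl

upd-diff : ∀ {V : Set} (ρ : ℕ → V) x v {a} → a ≢ x → upd ρ x v a ≡ ρ a
upd-diff ρ x v a≢x rewrite ≢⇒≡ᵇ-false a≢x = refl

-- The first occurrence of a repeated name wins, as for the iterated swaps in αA-inp.
upds : {V : Set} → (ℕ → V) → List ℕ → List V → ℕ → V
upds ρ (x ∷ xs) (v ∷ vs) = upd (upds ρ xs vs) x v
upds ρ _        _        = ρ

upds-∉ : ∀ {V : Set} (ρ : ℕ → V) xs vs {a} → a ∉ xs → upds ρ xs vs a ≡ ρ a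
upds-∉ ρ []       vs       a∉ = refl
upds-∉ ρ (x ∷ xs) []       a∉ = refl
upds-∉ ρ (x ∷ xs) (v ∷ vs) a∉ =
  trans (upd-diff (upds ρ xs vs) x v (a∉ ∘ here)) (upds-∉ ρ xs vs (a∉ ∘ there))

upds-cong : ∀ {V : Set} {ρ θ : ℕ → V} xs vs {a} → ρ a ≡ θ a → upds ρ xs vs a ≡ upds θ xs vs a
upds-cong []       vs       e = e
upds-cong (x ∷ xs) []       e = e
upds-cong (x ∷ xs) (v ∷ vs) {a} e with a ≡ᵇ x
... | true  = refl
... | false = upds-cong xs vs e

module Calculus (k : ℕ) (ar : Fin k → ℕ) (nq : ℕ) (qar : Fin nq → ℕ) where
  open Syntax k ar
  open Processes nq qar

  -- Substitution and renaming of messages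

  mutual
    -- Renamings and finite substitutions are both instances of substitution along a total
    -- environment, so extensionality and composition are proved once, for this form.
    sub : (Name → Msg) → Msg → Msg
    sub ρ (name a)   = ρ a
    sub ρ (app f Ms) = app f (subV ρ Ms)

    subV : ∀ {n} → (Name → Msg) → Vec Msg n → Vec Msg n
    subV ρ []       = []
    subV ρ (M ∷ Ms) = sub ρ M ∷ subV ρ Ms

  mutual
    sub-ext : ∀ {ρ θ} M → (∀ {a} → a ∈ names M → ρ a ≡ θ a) → sub ρ M ≡ sub θ M
    sub-ext (name a)   h = h (here refl)
    sub-ext (app f Ms) h = cong (app f) (subV-ext Ms h)

    subV-ext : ∀ {n ρ θ} (Ms : Vec Msg n) → (∀ {a} → a ∈ namesV Ms → ρ a ≡ θ a) → subV ρ Ms ≡ subV θ Ms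
    subV-ext []       h = refl
    subV-ext (M ∷ Ms) h = cong₂ _∷_ (sub-ext M (h ∘ ∈-++⁺ˡ)) (subV-ext Ms (h ∘ ∈-++⁺ʳ (names M)))

  mutual
    sub-sub : ∀ ρ θ M → sub ρ (sub θ M) ≡ sub (sub ρ ∘ θ) M
    sub-sub ρ θ (name a)   = refl
    sub-sub ρ θ (app f Ms) = cong (app f) (subV-subV ρ θ Ms)

    subV-subV : ∀ {n} ρ θ (Ms : Vec Msg n) → subV ρ (subV θ Ms) ≡ subV (sub ρ ∘ θ) Ms
    subV-subV ρ θ []       = refl
    subV-subV ρ θ (M ∷ Ms) = cong₂ _∷_ (sub-sub ρ θ M) (subV-subV ρ θ Ms)

  mutual
    sub-name : ∀ M → sub name M ≡ M
    sub-name (name a)   = refl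
    sub-name (app f Ms) = cong (app f) (subV-name Ms)

    subV-name : ∀ {n} (Ms : Vec Msg n) → subV name Ms ≡ Ms
    subV-name []       = refl
    subV-name (M ∷ Ms) = cong₂ _∷_ (sub-name M) (subV-name Ms)

  mutual
    rename-sub : ∀ θ M → rename θ M ≡ sub (name ∘ θ) M
    rename-sub θ (name a)   = refl
    rename-sub θ (app f Ms) = cong (app f) (renameV-subV θ Ms)

    renameV-subV : ∀ {n} θ (Ms : Vec Msg n) → renameV θ Ms ≡ subV (name ∘ θ) Ms
    renameV-subV θ []       = refl
    renameV-subV θ (M ∷ Ms) = cong₂ _∷_ (rename-sub θ M) (renameV-subV θ Ms)

  look : Subst → Name → Msg
  look σ a = substM σ (name a)

  mutual
    substM-sub : ∀ σ M → substM σ M ≡ sub (look σ) M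
    substM-sub σ (name a)   = refl
    substM-sub σ (app f Ms) = cong (app f) (substV-subV σ Ms)

    substV-subV : ∀ {n} σ (Ms : Vec Msg n) → substV σ Ms ≡ subV (look σ) Ms
    substV-subV σ []       = refl
    substV-subV σ (M ∷ Ms) = cong₂ _∷_ (substM-sub σ M) (substV-subV σ Ms)

  sub-rename : ∀ ρ θ M → sub ρ (rename θ M) ≡ sub (ρ ∘ θ) M
  sub-rename ρ θ M = trans (cong (sub ρ) (rename-sub θ M)) (sub-sub ρ (name ∘ θ) M)

  subV-renameV : ∀ {n} ρ θ (Ms : Vec Msg n) → subV ρ (renameV θ Ms) ≡ subV (ρ ∘ θ) Ms
  subV-renameV ρ θ Ms = trans (cong (subV ρ) (renameV-subV θ Ms)) (subV-subV ρ (name ∘ θ) Ms)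

  rename-ext : ∀ {ρ θ} M → (∀ {a} → a ∈ names M → ρ a ≡ θ a) → rename ρ M ≡ rename θ M
  rename-ext {ρ} {θ} M h =
    trans (rename-sub ρ M) (trans (sub-ext M (cong name ∘ h)) (sym (rename-sub θ M)))

  renameV-ext : ∀ {n ρ θ} (Ms : Vec Msg n) → (∀ {a} → a ∈ namesV Ms → ρ a ≡ θ a) → renameV ρ Ms ≡ renameV θ Ms
  renameV-ext {ρ = ρ} {θ} Ms h =
    trans (renameV-subV ρ Ms) (trans (subV-ext Ms (cong name ∘ h)) (sym (renameV-subV θ Ms)))

  rename-∘ : ∀ ρ θ M → rename ρ (rename θ M) ≡ rename (ρ ∘ θ) M
  rename-∘ ρ θ M =
    trans (rename-sub ρ _) (trans (sub-rename (name ∘ ρ) θ M) (sym (rename-sub (ρ ∘ θ) M)))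

  renameV-∘ : ∀ {n} ρ θ (Ms : Vec Msg n) → renameV ρ (renameV θ Ms) ≡ renameV (ρ ∘ θ) Ms
  renameV-∘ ρ θ Ms =
    trans (renameV-subV ρ _) (trans (subV-renameV (name ∘ ρ) θ Ms) (sym (renameV-subV (ρ ∘ θ) Ms)))

  rename-id : ∀ M → rename id M ≡ M
  rename-id M = trans (rename-sub id M) (sub-name M)

  renameV-id : ∀ {n} (Ms : Vec Msg n) → renameV id Ms ≡ Ms
  renameV-id Ms = trans (renameV-subV id Ms) (subV-name Ms)

  mutual
    names-rename : ∀ {a} θ M → a ∈ names (rename θ M) → Σ[ b ∈ Name ] (b ∈ names M × a ≡ θ b)
    names-rename θ (name b)   (here refl) = b , here refl , refl
    names-rename θ (app f Ms) p           = namesV-renameV θ Ms p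

    namesV-renameV : ∀ {n a} θ (Ms : Vec Msg n) → a ∈ namesV (renameV θ Ms) → Σ[ b ∈ Name ] (b ∈ namesV Ms × a ≡ θ b)
    namesV-renameV θ (M ∷ Ms) p with ∈-++⁻ (names (rename θ M)) p
    ... | inj₁ q = let b , b∈ , e = names-rename θ M q in b , ∈-++⁺ˡ b∈ , e
    ... | inj₂ q = let b , b∈ , e = namesV-renameV θ Ms q in b , ∈-++⁺ʳ (names M) b∈ , e

  -- Renaming of processes, with swaps as a special case

  -- Binders are renamed along with free names, so no freshness condition arises; when `θ` is
  -- injective on `allP P`, nothing is captured.
  renP : (Name → Name) → Proc → Proc
  renP θ 𝟘           = 𝟘
  renP θ (ν x P)     = ν (θ x) (renP θ P)
  renP θ (P ∥ Q)     = renP θ P ∥ renP θ Q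
  renP θ ⟪ M ⟫       = ⟪ rename θ M ⟫
  renP θ (call q Ms) = call q (renameV θ Ms)

  renA : (Name → Name) → Act → Act
  renA θ (out c M P)    = out (θ c) (rename θ M) (renP θ P)
  renA θ (inp c xs M P) = inp (θ c) (List.map θ xs) (rename θ M) (renP θ P)
  renA θ (A ⊕ B)        = renA θ A ⊕ renA θ B

  renP-ext : ∀ {ρ θ} P → (∀ {a} → a ∈ allP P → ρ a ≡ θ a) → renP ρ P ≡ renP θ P
  renP-ext 𝟘           h = refl
  renP-ext (ν x P)     h = cong₂ ν (h (here refl)) (renP-ext P (h ∘ there))
  renP-ext (P ∥ Q)     h = cong₂ _∥_ (renP-ext P (h ∘ ∈-++⁺ˡ)) (renP-ext Q (h ∘ ∈-++⁺ʳ (allP P)))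
  renP-ext ⟪ M ⟫       h = cong ⟪_⟫ (rename-ext M h)
  renP-ext (call q Ms) h = cong (call q) (renameV-ext Ms h)

  renP-∘ : ∀ ρ θ P → renP ρ (renP θ P) ≡ renP (ρ ∘ θ) P
  renP-∘ ρ θ 𝟘           = refl
  renP-∘ ρ θ (ν x P)     = cong (ν _) (renP-∘ ρ θ P)
  renP-∘ ρ θ (P ∥ Q)     = cong₂ _∥_ (renP-∘ ρ θ P) (renP-∘ ρ θ Q)
  renP-∘ ρ θ ⟪ M ⟫       = cong ⟪_⟫ (rename-∘ ρ θ M)
  renP-∘ ρ θ (call q Ms) = cong (call q) (renameV-∘ ρ θ Ms)

  renP-id : ∀ P → renP id P ≡ P
  renP-id 𝟘           = refl
  renP-id (ν x P)     = cong (ν x) (renP-id P)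
  renP-id (P ∥ Q)     = cong₂ _∥_ (renP-id P) (renP-id Q)
  renP-id ⟪ M ⟫       = cong ⟪_⟫ (rename-id M)
  renP-id (call q Ms) = cong (call q) (renameV-id Ms)

  allP-renP : ∀ {a} θ P → a ∈ allP (renP θ P) → Σ[ b ∈ Name ] (b ∈ allP P × a ≡ θ b)
  allP-renP θ (ν x P) (here refl) = x , here refl , refl
  allP-renP θ (ν x P) (there p)   = let b , b∈ , e = allP-renP θ P p in b , there b∈ , e
  allP-renP θ (P ∥ Q) p with ∈-++⁻ (allP (renP θ P)) p
  ... | inj₁ q = let b , b∈ , e = allP-renP θ P q in b , ∈-++⁺ˡ b∈ , e
  ... | inj₂ q = let b , b∈ , e = allP-renP θ Q q in b , ∈-++⁺ʳ (allP P) b∈ , e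
  allP-renP θ ⟪ M ⟫       p = names-rename θ M p
  allP-renP θ (call q Ms) p = namesV-renameV θ Ms p

  swapP-renP : ∀ a b P → swapP a b P ≡ renP (sw a b) P
  swapP-renP a b 𝟘           = refl
  swapP-renP a b (ν x P)     = cong (ν _) (swapP-renP a b P)
  swapP-renP a b (P ∥ Q)     = cong₂ _∥_ (swapP-renP a b P) (swapP-renP a b Q)
  swapP-renP a b ⟪ M ⟫       = refl
  swapP-renP a b (call q Ms) = refl

  sw-left : ∀ a b → sw a b a ≡ b
  sw-left a b rewrite ≡ᵇ-refl a = refl

  sw-right : ∀ a b → sw a b b ≡ a
  sw-right a b with b ≟ a
  ... | yes refl = sw-left a a
  ... | no b≢a rewrite ≢⇒≡ᵇ-false b≢a | ≡ᵇ-refl b = refl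

  sw-other : ∀ {a b n} → n ≢ a → n ≢ b → sw a b n ≡ n
  sw-other n≢a n≢b rewrite ≢⇒≡ᵇ-false n≢a | ≢⇒≡ᵇ-false n≢b = refl

  sw-involutive : ∀ a b n → sw a b (sw a b n) ≡ n
  sw-involutive a b n with n ≟ a | n ≟ b
  ... | yes refl | _        = trans (cong (sw a b) (sw-left a b)) (sw-right a b)
  ... | no _     | yes refl = trans (cong (sw a b) (sw-right a b)) (sw-left a b)
  ... | no n≢a   | no n≢b   = trans (cong (sw a b) (sw-other n≢a n≢b)) (sw-other n≢a n≢b)

  sw-injective : ∀ a b → Injective _≡_ _≡_ (sw a b)
  sw-injective a b {x} {y} e =
    trans (sym (sw-involutive a b x)) (trans (cong (sw a b) e) (sw-involutive a b y))

  swaps : List Name → List Name → Name → Name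
  swaps (x ∷ xs) (z ∷ zs) = swaps xs zs ∘ sw x z
  swaps _        _        = id

  swaps-injective : ∀ xs zs → Injective _≡_ _≡_ (swaps xs zs)
  swaps-injective []       zs       = id
  swaps-injective (x ∷ xs) []       = id
  swaps-injective (x ∷ xs) (z ∷ zs) = sw-injective x z ∘ swaps-injective xs zs

  swapsM-rename : ∀ xs zs M → swapsM xs zs M ≡ rename (swaps xs zs) M
  swapsM-rename []       zs       M = sym (rename-id M)
  swapsM-rename (x ∷ xs) []       M = sym (rename-id M)
  swapsM-rename (x ∷ xs) (z ∷ zs) M =
    trans (swapsM-rename xs zs (swapM x z M)) (rename-∘ (swaps xs zs) (sw x z) M)

  swapsP-renP : ∀ xs zs P → swapsP xs zs P ≡ renP (swaps xs zs) P
  swapsP-renP []       zs       P = sym (renP-id P)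
  swapsP-renP (x ∷ xs) []       P = sym (renP-id P)
  swapsP-renP (x ∷ xs) (z ∷ zs) P = trans (swapsP-renP xs zs (swapP x z P))
    (trans (cong (renP (swaps xs zs)) (swapP-renP x z P)) (renP-∘ (swaps xs zs) (sw x z) P))

  swaps-fixed : ∀ xs zs {a} → a ∉ xs → a ∉ zs → swaps xs zs a ≡ a
  swaps-fixed []       zs       p q = refl
  swaps-fixed (x ∷ xs) []       p q = refl
  swaps-fixed (x ∷ xs) (z ∷ zs) p q =
    trans (cong (swaps xs zs) (sw-other (p ∘ here) (q ∘ here))) (swaps-fixed xs zs (p ∘ there) (q ∘ there))

  -- The first occurrence of `a` in `xs` is swapped to the matching `z`, which the later swaps fix
  -- because `zs` is duplicate-free and disjoint from `xs`. Names of `zs` are excluded since the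
  -- swaps move them back into `xs`.
  swaps-upds : ∀ {V : Set} (f : Name → V) xs zs vs → Unique zs → (∀ {z} → z ∈ zs → z ∉ xs) →
               length zs ≡ length xs → List.map f zs ≡ vs →
               ∀ {a} → a ∉ zs → f (swaps xs zs a) ≡ upds f xs vs a
  swaps-upds f []       []       _ _ _ _ _ _ = refl
  swaps-upds f (x ∷ xs) (z ∷ zs) (_ ∷ vs) (z∉ ∷ uz) disj len refl {a} a∉ with a ≟ x
  ... | yes refl = begin
    f (swaps xs zs (sw a z a)) ≡⟨ cong (f ∘ swaps xs zs) (sw-left a z) ⟩
    f (swaps xs zs z)          ≡⟨ cong f (swaps-fixed xs zs (disj (here refl) ∘ there) (λ p → All.lookup z∉ p refl)) ⟩
    f z                        ≡⟨ upd-same (upds f xs vs') a (f z) ⟨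
    upds f (a ∷ xs) (f z ∷ vs') a ∎
    where open ≡-Reasoning
          vs' = List.map f zs
  ... | no a≢x = begin
    f (swaps xs zs (sw x z a)) ≡⟨ cong (f ∘ swaps xs zs) (sw-other a≢x (a∉ ∘ here)) ⟩
    f (swaps xs zs a)          ≡⟨ swaps-upds f xs zs vs' uz (λ p q → disj (there p) (there q)) (suc-injective len) refl (a∉ ∘ there) ⟩
    upds f xs vs' a            ≡⟨ upd-diff (upds f xs vs') x (f z) a≢x ⟨
    upds f (x ∷ xs) (f z ∷ vs') a ∎
    where open ≡-Reasoning
          
          vs' = List.map f zs

  memᵇ-∉ : ∀ {a} xs → a ∉ xs → memᵇ a xs ≡ false
  memᵇ-∉ []       _ = refl
  memᵇ-∉ (x ∷ xs) p rewrite ≢⇒≡ᵇ-false (p ∘ here) = memᵇ-∉ xs (p ∘ there)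

  ∈-remove : ∀ xs {a} L → a ∈ L → a ∉ xs → a ∈ remove xs L
  ∈-remove xs (b ∷ L) (here refl) a∉ rewrite memᵇ-∉ xs a∉ = here refl
  ∈-remove xs (b ∷ L) (there p) a∉ with not (memᵇ b xs)
  ... | true  = there (∈-remove xs L p a∉)
  ... | false = ∈-remove xs L p a∉

  remove-⊆ : ∀ xs {a} L → a ∈ remove xs L → a ∈ L
  remove-⊆ xs (b ∷ L) p with not (memᵇ b xs) | p
  ... | true  | here e  = here e
  ... | true  | there q = there (remove-⊆ xs L q)
  ... | false | q       = there (remove-⊆ xs L q)

  fnP⊆allP : ∀ {a} P → a ∈ fnP P → a ∈ allP P
  fnP⊆allP (ν x P) p = there (fnP⊆allP P (remove-⊆ (x ∷ []) (fnP P) p))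
  fnP⊆allP (P ∥ Q) p with ∈-++⁻ (fnP P) p
  ... | inj₁ q = ∈-++⁺ˡ (fnP⊆allP P q)
  ... | inj₂ q = ∈-++⁺ʳ (allP P) (fnP⊆allP Q q)
  fnP⊆allP ⟪ M ⟫       p = p
  fnP⊆allP (call q Ms) p = p

  ∈-fnP-ν : ∀ x {a} P → a ∈ fnP P → a ≢ x → a ∈ fnP (ν x P)
  ∈-fnP-ν x P p a≢x = ∈-remove (x ∷ []) (fnP P) p λ { (here e) → a≢x e }

  -- Canonical bound names

  -- chan (name c) is c; other messages are never used as channels.
  chan : Msg → Name
  chan M = List.foldr const 0 (names M)

  fresh : ℕ → List Name → List Msg
  fresh n xs = List.map name (block n (length xs))

  -- Applies ρ, renaming the binders to n, n+1, …; this is capture-free when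
  -- the names in the range of ρ are below n.
  canonP : ℕ → (Name → Msg) → Proc → Proc
  canonP n ρ 𝟘           = 𝟘
  canonP n ρ (ν x P)     = ν n (canonP (suc n) (upd ρ x (name n)) P)
  canonP n ρ (P ∥ Q)     = canonP n ρ P ∥ canonP n ρ Q
  canonP n ρ ⟪ M ⟫       = ⟪ sub ρ M ⟫
  canonP n ρ (call q Ms) = call q (subV ρ Ms)

  canonA : ℕ → (Name → Msg) → Act → Act
  canonA n ρ (out c M P)    = out (chan (ρ c)) (sub ρ M) (canonP n ρ P)
  canonA n ρ (inp c xs M P) =
    let ρ' = upds ρ xs (fresh n xs) in
    inp (chan (ρ c)) (block n (length xs)) (sub ρ' M) (canonP (length xs + n) ρ' P)
  canonA n ρ (A ⊕ B)        = canonA n ρ A ⊕ canonA n ρ B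

  upd-cong-fn : ∀ {V : Set} {ρ θ : Name → V} x v P → (∀ {a} → a ∈ fnP (ν x P) → ρ a ≡ θ a) →
                ∀ {a} → a ∈ fnP P → upd ρ x v a ≡ upd θ x v a
  upd-cong-fn {ρ = ρ} {θ} x v P h {a} p with a ≟ x
  ... | yes refl = trans (upd-same ρ x v) (sym (upd-same θ x v))
  ... | no a≢x   =
    trans (upd-diff ρ x v a≢x) (trans (h (∈-fnP-ν x P p a≢x)) (sym (upd-diff θ x v a≢x)))

  canonP-ext : ∀ {n ρ θ} P → (∀ {a} → a ∈ fnP P → ρ a ≡ θ a) → canonP n ρ P ≡ canonP n θ P
  canonP-ext 𝟘           h = refl
  canonP-ext (ν x P)     h = cong (ν _) (canonP-ext P (upd-cong-fn x _ P h))
  canonP-ext (P ∥ Q)     h = cong₂ _∥_ (canonP-ext P (h ∘ ∈-++⁺ˡ)) (canonP-ext Q (h ∘ ∈-++⁺ʳ (fnP P)))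
  canonP-ext ⟪ M ⟫       h = cong ⟪_⟫ (sub-ext M h)
  canonP-ext (call q Ms) h = cong (call q) (subV-ext Ms h)

  inp-cong : ∀ {c c' xs xs' M M' P P'} → c ≡ c' → xs ≡ xs' → M ≡ M' → P ≡ P' →
             inp c xs M P ≡ inp c' xs' M' P'
  inp-cong refl refl refl refl = refl

  out-cong : ∀ {c c' M M' P P'} → c ≡ c' → M ≡ M' → P ≡ P' → out c M P ≡ out c' M' P'
  out-cong refl refl refl = refl

  upds-cong-fn : ∀ {V : Set} {ρ θ : Name → V} L xs vs → length vs ≡ length xs →
                 (∀ {a} → a ∈ remove xs L → ρ a ≡ θ a) →
                 ∀ {a} → a ∈ L → upds ρ xs vs a ≡ upds θ xs vs a
  upds-cong-fn {ρ = ρ} {θ} L xs vs len h {a} p = go xs vs len (h ∘ ∈-remove xs L p)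
    where
    go : ∀ ys ws → length ws ≡ length ys → (a ∉ ys → ρ a ≡ θ a) → upds ρ ys ws a ≡ upds θ ys ws a
    go []       []       _ g = g λ ()
    go (y ∷ ys) (w ∷ ws) l g with a ≟ y
    ... | yes refl = trans (upd-same (upds ρ ys ws) y w) (sym (upd-same (upds θ ys ws) y w))
    ... | no a≢y   = trans (upd-diff (upds ρ ys ws) y w a≢y)
      (trans (go ys ws (suc-injective l) (λ q → g λ { (here e) → a≢y e ; (there r) → q r }))
             (sym (upd-diff (upds θ ys ws) y w a≢y)))

  length-fresh : ∀ n xs → length (fresh n xs) ≡ length xs
  length-fresh n xs = trans (length-map name (block n (length xs))) (length-block n (length xs))

  canonA-ext : ∀ {n ρ θ} A → (∀ {a} → a ∈ fnA A → ρ a ≡ θ a) → canonA n ρ A ≡ canonA n θ A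
  canonA-ext (out c M P) h = out-cong (cong chan (h (here refl)))
    (sub-ext M (h ∘ there ∘ ∈-++⁺ˡ)) (canonP-ext P (h ∘ there ∘ ∈-++⁺ʳ (names M)))
  canonA-ext {n} {ρ} {θ} (inp c xs M P) h = inp-cong (cong chan (h (here refl))) refl
    (sub-ext M (g ∘ ∈-++⁺ˡ)) (canonP-ext P (g ∘ ∈-++⁺ʳ (names M)))
    where
    g : ∀ {a} → a ∈ names M ++ fnP P → upds ρ xs (fresh n xs) a ≡ upds θ xs (fresh n xs) a
    g = upds-cong-fn (names M ++ fnP P) xs (fresh n xs) (length-fresh n xs) (h ∘ there)
  canonA-ext (A ⊕ B) h = cong₂ _⊕_ (canonA-ext A (h ∘ ∈-++⁺ˡ)) (canonA-ext B (h ∘ ∈-++⁺ʳ (fnA A)))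

  upd-∘ : ∀ {V : Set} (ρ : Name → V) π x v {L} → InjOn L π → x ∈ L →
          ∀ {a} → a ∈ L → upd ρ (π x) v (π a) ≡ upd (ρ ∘ π) x v a
  upd-∘ ρ π x v inj x∈ {a} a∈ with a ≟ x
  ... | yes refl = trans (upd-same ρ (π x) v) (sym (upd-same (ρ ∘ π) x v))
  ... | no a≢x   = trans (upd-diff ρ (π x) v (a≢x ∘ inj a∈ x∈)) (sym (upd-diff (ρ ∘ π) x v a≢x))

  upds-∘ : ∀ {V : Set} (ρ : Name → V) π xs vs → Injective _≡_ _≡_ π →
           ∀ a → upds ρ (List.map π xs) vs (π a) ≡ upds (ρ ∘ π) xs vs a
  upds-∘ ρ π []       vs       inj a = refl
  upds-∘ ρ π (x ∷ xs) []       inj a = refl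
  upds-∘ ρ π (x ∷ xs) (v ∷ vs) inj a with a ≟ x
  ... | yes refl = trans (upd-same ρπ (π x) v) (sym (upd-same θ x v))
    where ρπ = upds ρ (List.map π xs) vs
          θ  = upds (ρ ∘ π) xs vs
  ... | no a≢x   = trans (upd-diff ρπ (π x) v (a≢x ∘ inj))
                         (trans (upds-∘ ρ π xs vs inj a) (sym (upd-diff θ x v a≢x)))
    where ρπ = upds ρ (List.map π xs) vs
          θ  = upds (ρ ∘ π) xs vs

  -- The binder `π x` is replaced by `n` exactly as `x` is, so only the action of `π` on free names
  -- survives. Injectivity keeps a free name from being identified with a binder.
  canonP-ren : ∀ {n ρ} π P → InjOn (allP P) π → canonP n ρ (renP π P) ≡ canonP n (ρ ∘ π) P
  canonP-ren π 𝟘 inj = refl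
  canonP-ren {ρ = ρ} π (ν x P) inj = cong (ν _) (trans
    (canonP-ren π P (λ p q → inj (there p) (there q)))
    (canonP-ext P (λ p → upd-∘ ρ π x _ inj (here refl) (there (fnP⊆allP P p)))))
  canonP-ren π (P ∥ Q) inj = cong₂ _∥_
    (canonP-ren π P (λ p q → inj (∈-++⁺ˡ p) (∈-++⁺ˡ q)))
    (canonP-ren π Q (λ p q → inj (∈-++⁺ʳ (allP P) p) (∈-++⁺ʳ (allP P) q)))
  canonP-ren {ρ = ρ} π ⟪ M ⟫       inj = cong ⟪_⟫ (sub-rename ρ π M)
  canonP-ren {ρ = ρ} π (call q Ms) inj = cong (call q) (subV-renameV ρ π Ms)

  canonA-ren : ∀ {n ρ} π A → Injective _≡_ _≡_ π → canonA n ρ (renA π A) ≡ canonA n (ρ ∘ π) A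
  canonA-ren {n} {ρ} π (out c M P) inj =
    out-cong refl (sub-rename ρ π M) (canonP-ren π P (λ _ _ → inj))
  canonA-ren {n} {ρ} π (inp c xs M P) inj rewrite length-map π xs = inp-cong refl refl
    (trans (sub-rename _ π M) (sub-ext M (λ {a} _ → upds-∘ ρ π xs (fresh n xs) inj a)))
    (trans (canonP-ren π P (λ _ _ → inj)) (canonP-ext P (λ {a} _ → upds-∘ ρ π xs (fresh n xs) inj a)))
  canonA-ren π (A ⊕ B) inj = cong₂ _⊕_ (canonA-ren π A inj) (canonA-ren π B inj)

  canonP-swap : ∀ {n ρ} x z v P → z ∉ allP P →
                canonP n (upd ρ z v) (swapP x z P) ≡ canonP n (upd ρ x v) P
  canonP-swap {n} {ρ} x z v P z∉ = begin
    canonP n (upd ρ z v) (swapP x z P)       ≡⟨ cong (canonP n _) (swapP-renP x z P) ⟩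
    canonP n (upd ρ z v) (renP (sw x z) P)   ≡⟨ canonP-ren (sw x z) P (λ _ _ → sw-injective x z) ⟩
    canonP n (upd ρ z v ∘ sw x z) P          ≡⟨ canonP-ext P agree ⟩
    canonP n (upd ρ x v) P                   ∎
    where
    open ≡-Reasoning
    agree : ∀ {a} → a ∈ fnP P → upd ρ z v (sw x z a) ≡ upd ρ x v a
    agree {a} p with a ≟ x
    ... | yes refl = trans (cong (upd ρ z v) (sw-left x z)) (trans (upd-same ρ z v) (sym (upd-same ρ x v)))
    ... | no a≢x   = trans (cong (upd ρ z v) (sw-other a≢x a≢z)) (trans (upd-diff ρ z v a≢z) (sym (upd-diff ρ x v a≢x)))
      where a≢z = λ { refl → z∉ (fnP⊆allP P p) }

  -- The environment has to vary in the induction: under `α-ν` the hypothesis is used with the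
  -- common name `z` sent to `n`, and `canonP-swap` trades `z` for the original binder on either
  -- side.
  canonP-sound : ∀ {n ρ P Q} → P =α Q → canonP n ρ P ≡ canonP n ρ Q
  canonP-sound α-𝟘 = refl
  canonP-sound {n} (α-ν {x} {y} {P} {Q} z z∉P z∉Q p) = cong (ν n)
    (trans (sym (canonP-swap x z (name n) P (z∉P ∘ there)))
    (trans (canonP-sound p) (canonP-swap y z (name n) Q (z∉Q ∘ there))))
  canonP-sound (α-∥ p q) = cong₂ _∥_ (canonP-sound p) (canonP-sound q)
  canonP-sound α-⟪⟫   = refl
  canonP-sound α-call = refl

  map-upds : ∀ {V : Set} (ρ : Name → V) zs vs → Unique zs → length vs ≡ length zs → List.map (upds ρ zs vs) zs ≡ vs
  map-upds ρ []       []       _        _   = refl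
  map-upds ρ (z ∷ zs) (v ∷ vs) (z∉ ∷ u) len = cong₂ _∷_ (upd-same (upds ρ zs vs) z v)
    (trans (map-cong-local (All.map (λ z≢ → upd-diff (upds ρ zs vs) z v (z≢ ∘ sym)) z∉))
           (map-upds ρ zs vs u (suc-injective len)))

  Avoids : List Name → List Name → Msg → Proc → Set
  Avoids zs xs M P = All (λ z → z ∉ xs × z ∉ names M × z ∉ allP P) zs

  avoids : ∀ {c zs} xs M P → All (_∉ allA (inp c xs M P)) zs → Avoids zs xs M P
  avoids xs M P = All.map λ z∉ → z∉ ∘ there ∘ ∈-++⁺ˡ
    , z∉ ∘ there ∘ ∈-++⁺ʳ xs ∘ ∈-++⁺ˡ , z∉ ∘ there ∘ ∈-++⁺ʳ xs ∘ ∈-++⁺ʳ (names M)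

  module _ {zs xs} M P (ρ : Name → Msg) (vs : List Msg) (uz : Unique zs)
           (len : length zs ≡ length xs) (lenv : length vs ≡ length zs) (av : Avoids zs xs M P) where

    upds-swaps : ∀ {a} → a ∉ zs → upds ρ zs vs (swaps xs zs a) ≡ upds ρ xs vs a
    upds-swaps {a} a∉ = trans
      (swaps-upds (upds ρ zs vs) xs zs vs uz (proj₁ ∘ All.lookup av) len (map-upds ρ zs vs uz lenv) a∉)
      (upds-cong xs vs (upds-∉ ρ zs vs a∉))

    sub-swaps : sub (upds ρ zs vs) (swapsM xs zs M) ≡ sub (upds ρ xs vs) M
    sub-swaps = trans (cong (sub _) (swapsM-rename xs zs M)) (trans (sub-rename _ _ M)
      (sub-ext M λ p → upds-swaps (λ q → proj₁ (proj₂ (All.lookup av q)) p)))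

    canonP-swaps : ∀ {n} → canonP n (upds ρ zs vs) (swapsP xs zs P) ≡ canonP n (upds ρ xs vs) P
    canonP-swaps = trans (cong (canonP _ _) (swapsP-renP xs zs P))
      (trans (canonP-ren _ P (λ _ _ → swaps-injective xs zs))
      (canonP-ext P λ p → upds-swaps (λ q → proj₂ (proj₂ (All.lookup av q)) (fnP⊆allP P p))))

  canonA-sound : ∀ {n ρ A B} → A =αA B → canonA n ρ A ≡ canonA n ρ B
  canonA-sound (αA-out p) = cong (out _ _) (canonP-sound p)
  canonA-sound {n} {ρ} (αA-inp {c} {xs} {ys} {N} {N'} {P} {P'} zs uz lx ly ax ay eN eP)
    rewrite trans (sym lx) ly = inp-cong refl refl
      (trans (sym (sub-swaps N P ρ vs uz lx lv (avoids xs N P ax)))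
        (trans (cong (sub _) eN) (sub-swaps N' P' ρ vs uz ly lv (avoids ys N' P' ay))))
      (trans (sym (canonP-swaps N P ρ vs uz lx lv (avoids xs N P ax)))
        (trans (canonP-sound eP) (canonP-swaps N' P' ρ vs uz ly lv (avoids ys N' P' ay))))
    where
    vs = fresh n ys
    lv : length vs ≡ length zs
    lv = trans (length-fresh n ys) (sym ly)
  canonA-sound (αA-⊕ p q) = cong₂ _⊕_ (canonA-sound p) (canonA-sound q)

  -- Completeness of canonical forms for α-equivalence

  -- The equation `canonP n ρ P ≡ T`, inverted along the head of `T`. It allows recursion on the
  -- common canonical form `T`, which is needed because the swapped bodies met under `ν` are not
  -- subterms.
  data Canon (n : ℕ) (ρ : Name → Msg) : Proc → Proc → Set where
    c-𝟘    : Canon n ρ 𝟘 𝟘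
    c-ν    : ∀ {x P T} → canonP (suc n) (upd ρ x (name n)) P ≡ T → Canon n ρ (ν x P) (ν n T)
    c-∥    : ∀ {P Q T U} → canonP n ρ P ≡ T → canonP n ρ Q ≡ U → Canon n ρ (P ∥ Q) (T ∥ U)
    c-⟪⟫   : ∀ {M N} → sub ρ M ≡ N → Canon n ρ ⟪ M ⟫ ⟪ N ⟫
    c-call : ∀ {q Ms Ns} → subV ρ Ms ≡ Ns → Canon n ρ (call q Ms) (call q Ns)

  canon-view : ∀ {n ρ T} P → canonP n ρ P ≡ T → Canon n ρ P T
  canon-view 𝟘           refl = c-𝟘
  canon-view (ν x P)     refl = c-ν refl
  canon-view (P ∥ Q)     refl = c-∥ refl refl
  canon-view ⟪ M ⟫       refl = c-⟪⟫ refl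
  canon-view (call q Ms) refl = c-call refl

  Below : ℕ → List Name → Set
  Below n L = ∀ {a} → a ∈ L → a < n

  sw-< : ∀ x n {b} → b < n → sw x n b < suc n
  sw-< x n {b} b<n with b ≟ x
  ... | yes refl = subst (_< suc n) (sym (sw-left b n)) (n<1+n n)
  ... | no b≢x   = subst (_< suc n) (sym (sw-other b≢x (<⇒≢ b<n))) (m<n⇒m<1+n b<n)

  below-swap : ∀ x {n} P → Below n (allP P) → Below (suc n) (allP (swapP x n P))
  below-swap x {n} P bd {a} p with allP-renP (sw x n) P (subst (λ R → a ∈ allP R) (swapP-renP x n P) p)
  ... | b , b∈ , refl = sw-< x n (bd b∈)

  upd-name : ∀ n {a} → upd name n (name n) a ≡ name a
  upd-name n {a} with a ≟ n
  ... | yes refl = upd-same name n (name n)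
  ... | no a≢n   = upd-diff name n (name n) a≢n

  -- Swapping the binder to its canonical name `n` turns the updated environment back into `name`,
  -- the form that the recursion of `canonP-complete` needs.
  canonP-opened : ∀ {n x T} P → Below n (allP (ν x P)) → canonP (suc n) (upd name x (name n)) P ≡ T →
                  canonP (suc n) name (swapP x n P) ≡ T
  canonP-opened {n} {x} P bd refl = trans
    (canonP-ext (swapP x n P) (λ _ → sym (upd-name n)))
    (canonP-swap x n (name n) P (λ p → <-irrefl refl (bd (there p))))

  -- The canonical binder is itself the witness: `n` lies above all names of both sides, so it is
  -- the fresh name that `α-ν` demands, and after the two swaps all names lie below `suc n`.
  canonP-complete : ∀ T {n P Q} → Below n (allP P) → Below n (allP Q) →
                    Canon n name P T → Canon n name Q T → P =α Q
  canonP-complete 𝟘 bP bQ c-𝟘 c-𝟘 = α-𝟘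
  canonP-complete (ν n T) bP bQ (c-ν {x} {P} p) (c-ν {y} {Q} q) =
    α-ν n (<-irrefl refl ∘ bP) (<-irrefl refl ∘ bQ)
      (canonP-complete T (below-swap x P (bP ∘ there)) (below-swap y Q (bQ ∘ there))
        (canon-view (swapP x n P) (canonP-opened P bP p))
        (canon-view (swapP y n Q) (canonP-opened Q bQ q)))
  canonP-complete (T ∥ U) bP bQ (c-∥ {P} {P'} p p') (c-∥ {Q} {Q'} q q') = α-∥
    (canonP-complete T (bP ∘ ∈-++⁺ˡ) (bQ ∘ ∈-++⁺ˡ) (canon-view P p) (canon-view Q q))
    (canonP-complete U (bP ∘ ∈-++⁺ʳ (allP P)) (bQ ∘ ∈-++⁺ʳ (allP Q)) (canon-view P' p') (canon-view Q' q'))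
  canonP-complete ⟪ N ⟫ bP bQ (c-⟪⟫ {M} p) (c-⟪⟫ {M'} q)
    with trans (sym (sub-name M)) (trans (trans p (sym q)) (sub-name M'))
  ... | refl = α-⟪⟫
  canonP-complete (call _ Ns) bP bQ (c-call {Ms = Ms} p) (c-call {Ms = Ms'} q)
    with trans (sym (subV-name Ms)) (trans (trans p (sym q)) (subV-name Ms'))
  ... | refl = α-call

  -- Quantifying over `n` lets the level be chosen above all names of `P` and `Q`. Chains of
  -- α-equivalences, symmetry and renaming all go through this lemma, as equations can be composed
  -- where `=α` derivations cannot be directly.
  canon⇒=α : ∀ {P Q} → (∀ n → canonP n name P ≡ canonP n name Q) → P =α Q
  canon⇒=α {P} {Q} h = canonP-complete (canonP n name P)
    (∈⇒<bound ∘ ∈-++⁺ˡ) (∈⇒<bound ∘ ∈-++⁺ʳ (allP P)) (canon-view P refl) (canon-view Q (sym (h n)))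
    where n = bound (allP P ++ allP Q)

  below-swaps : ∀ xs {m} n P → Below n (allP P) → length xs ≡ m →
                Below (m + n) (allP (swapsP xs (block n m) P))
  below-swaps []       n P bd refl = bd
  below-swaps (x ∷ xs) n P bd refl = subst (λ j → Below j (allP (swapsP xs (block (suc n) (length xs)) (swapP x n P)))) (+-suc (length xs) n)
    (below-swaps xs (suc n) (swapP x n P) (below-swap x P bd) refl)

  upds-self : ∀ zs {a} → upds name zs (List.map name zs) a ≡ name a
  upds-self []       = refl
  upds-self (z ∷ zs) {a} with a ≟ z
  ... | yes refl = upd-same (upds name zs (List.map name zs)) z (name z)
  ... | no a≢z   = trans (upd-diff (upds name zs (List.map name zs)) z (name z) a≢z) (upds-self zs)

  out-injective : ∀ {c c' M M' P P'} → out c M P ≡ out c' M' P' → c ≡ c' × M ≡ M' × P ≡ P'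
  out-injective refl = refl , refl , refl

  inp-injective : ∀ {c c' xs xs' M M' P P'} → inp c xs M P ≡ inp c' xs' M' P' →
                  c ≡ c' × xs ≡ xs' × M ≡ M' × P ≡ P'
  inp-injective refl = refl , refl , refl , refl

  ⊕-injective : ∀ {A A' B B'} → (A ⊕ A') ≡ (B ⊕ B') → A ≡ B × A' ≡ B'
  ⊕-injective refl = refl , refl

  -- For inputs the witness for `αA-inp` is the block of canonical binders. After the swaps these
  -- names are sent to themselves, so the environment acts as `name` (`upds-self`) and the bodies
  -- fall under `canonP-complete`.
  canonA-complete : ∀ {n} A B → Below n (allA A) → Below n (allA B) →
                    canonA n name A ≡ canonA n name B → A =αA B
  canonA-complete {n} (out c M P) (out d N Q) bA bB e
    with out-injective e
  ... | refl , eM , eP with trans (sym (sub-name M)) (trans eM (sub-name N))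
  ... | refl = αA-out (canonP-complete (canonP n name P)
    (bA ∘ there ∘ ∈-++⁺ʳ (names M)) (bB ∘ there ∘ ∈-++⁺ʳ (names M))
    (canon-view P refl) (canon-view Q (sym eP)))
  canonA-complete {n} (inp c xs M P) (inp d ys N Q) bA bB e
    with inp-injective e
  ... | refl , exs , eM , eP = αA-inp zs (block-unique n m) (length-block n m)
      (trans (length-block n m) lxy) aA aB
      (trans (sym (sub-name _)) (trans (sub-ext (swapsM xs zs M) (λ {a} _ → sym (upds-self zs {a})))
        (trans (sub-swaps M P name vs uz (length-block n m) lv (avoids xs M P aA))
        (trans eM (trans (cong (λ j → sub (upds name ys (List.map name (block n j))) N) (sym lxy))
        (trans (sym (sub-swaps N Q name vs uz (trans (length-block n m) lxy) lv (avoids ys N Q aB)))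
          (trans (sub-ext (swapsM ys zs N) (λ {a} _ → upds-self zs {a})) (sub-name _))))))))
      (canonP-complete (canonP (m + n) name (swapsP xs zs P)) bdP bdQ
        (canon-view (swapsP xs zs P) refl) (canon-view (swapsP ys zs Q) (sym eP')))
    where
    m  = length xs
    zs = block n m
    uz = block-unique n m
    vs = List.map name zs
    lv : length vs ≡ length zs
    lv = length-map name zs
    lxy : length xs ≡ length ys
    lxy = trans (sym (length-block n m)) (trans (cong length exs) (length-block n (length ys)))
    above : ∀ {L} → Below n L → All (_∉ L) zs
    above b = All.tabulate (λ z∈ p → <-irrefl refl (≤-trans (b p) (∈-block⇒≤ n m z∈)))
    aA : All (_∉ allA (inp c xs M P)) zs
    aA = above bA
    aB : All (_∉ allA (inp c ys N Q)) zs
    aB = above bB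
    bdP : Below (m + n) (allP (swapsP xs zs P))
    bdP = below-swaps xs n P (bA ∘ there ∘ ∈-++⁺ʳ xs ∘ ∈-++⁺ʳ (names M)) refl
    bdQ : Below (m + n) (allP (swapsP ys zs Q))
    bdQ = below-swaps ys n Q (bB ∘ there ∘ ∈-++⁺ʳ ys ∘ ∈-++⁺ʳ (names N)) (sym lxy)
    eP' : canonP (m + n) name (swapsP xs zs P) ≡ canonP (m + n) name (swapsP ys zs Q)
    eP' = trans (canonP-ext (swapsP xs zs P) (λ _ → sym (upds-self zs)))
      (trans (canonP-swaps M P name vs uz (length-block n m) lv (avoids xs M P aA))
      (trans eP (trans (cong (λ j → canonP (j + n) (upds name ys (List.map name (block n j))) Q) (sym lxy))
      (trans (sym (canonP-swaps N Q name vs uz (trans (length-block n m) lxy) lv (avoids ys N Q aB)))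
        (canonP-ext (swapsP ys zs Q) (λ _ → upds-self zs))))))
  canonA-complete (A ⊕ A') (B ⊕ B') bA bB e with ⊕-injective e
  ... | eA , eB = αA-⊕ (canonA-complete A B (bA ∘ ∈-++⁺ˡ) (bB ∘ ∈-++⁺ˡ) eA)
    (canonA-complete A' B' (bA ∘ ∈-++⁺ʳ (allA A)) (bB ∘ ∈-++⁺ʳ (allA B)) eB)
  canonA-complete (out _ _ _)   (inp _ _ _ _) _ _ ()
  canonA-complete (out _ _ _)   (_ ⊕ _)       _ _ ()
  canonA-complete (inp _ _ _ _) (out _ _ _)   _ _ ()
  canonA-complete (inp _ _ _ _) (_ ⊕ _)       _ _ ()
  canonA-complete (_ ⊕ _)       (out _ _ _)   _ _ ()
  canonA-complete (_ ⊕ _)       (inp _ _ _ _) _ _ ()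

  canon⇒=αA : ∀ {A B} → (∀ n → canonA n name A ≡ canonA n name B) → A =αA B
  canon⇒=αA {A} {B} h = canonA-complete A B
    (∈⇒<bound ∘ ∈-++⁺ˡ) (∈⇒<bound ∘ ∈-++⁺ʳ (allA A)) (h (bound (allA A ++ allA B)))

  ≈A-ren : ∀ {A B} π → Injective _≡_ _≡_ π → A ≈A B → renA π A ≈A renA π B
  ≈A-ren {A} {B} π inj (≈-α p) = ≈-α (canon⇒=αA λ n → trans (canonA-ren π A inj)
    (trans (canonA-sound p) (sym (canonA-ren π B inj))))
  ≈A-ren π inj ≈-refl        = ≈-refl
  ≈A-ren π inj (≈-sym p)     = ≈-sym (≈A-ren π inj p)
  ≈A-ren π inj (≈-trans p q) = ≈-trans (≈A-ren π inj p) (≈A-ren π inj q)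
  ≈A-ren π inj ≈-assoc       = ≈-assoc
  ≈A-ren π inj ≈-comm        = ≈-comm
  ≈A-ren π inj (≈-⊕ p q)     = ≈-⊕ (≈A-ren π inj p) (≈A-ren π inj q)

  -- Substitution and renaming

  look-here : ∀ a M σ → look ((a , M) ∷ σ) a ≡ M
  look-here a M σ rewrite ≡ᵇ-refl a = refl

  look-there : ∀ {a b} M σ → a ≢ b → look ((b , M) ∷ σ) a ≡ look σ a
  look-there M σ a≢b rewrite ≢⇒≡ᵇ-false a≢b = refl

  look-names : ∀ σ {a b} → b ∈ names (look σ a) → b ≡ a ⊎ b ∈ rangeσ σ
  look-names []            (here e) = inj₁ e
  look-names ((c , M) ∷ σ) {a} {b} p with a ≟ c
  ... | yes refl = inj₂ (∈-++⁺ˡ (subst (λ N → b ∈ names N) (look-here c M σ) p))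
  ... | no a≢c with look-names σ (subst (λ N → b ∈ names N) (look-there M σ a≢c) p)
  ...   | inj₁ e = inj₁ e
  ...   | inj₂ q = inj₂ (∈-++⁺ʳ (names M) q)

  memᵇ-∈ : ∀ {a} xs → a ∈ xs → memᵇ a xs ≡ true
  memᵇ-∈ {a} (x ∷ xs) (here refl) rewrite ≡ᵇ-refl a = refl
  memᵇ-∈ {a} (x ∷ xs) (there p) with a ≡ᵇ x
  ... | true  = refl
  ... | false = memᵇ-∈ xs p

  look-removed : ∀ xs σ {a} → a ∈ xs → look (removeσ xs σ) a ≡ name a
  look-removed xs [] p = refl
  look-removed xs ((b , M) ∷ σ) {a} p with memᵇ b xs in eq
  ... | true  = look-removed xs σ p
  ... | false = trans (look-there M (removeσ xs σ) a≢b) (look-removed xs σ p)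
    where
    a≢b : a ≢ b
    a≢b refl with trans (sym eq) (memᵇ-∈ xs p)
    ... | ()

  look-kept : ∀ xs σ {a} → a ∉ xs → look (removeσ xs σ) a ≡ look σ a
  look-kept xs [] p = refl
  look-kept xs ((b , M) ∷ σ) {a} p with memᵇ b xs in eq | a ≟ b
  ... | true  | yes refl with trans (sym eq) (memᵇ-∉ xs p)
  ...   | ()
  look-kept xs ((b , M) ∷ σ) p | true  | no a≢b   = trans (look-kept xs σ p) (sym (look-there M σ a≢b))
  look-kept xs ((b , M) ∷ σ) p | false | yes refl =
    trans (look-here b M (removeσ xs σ)) (sym (look-here b M σ))
  look-kept xs ((b , M) ∷ σ) p | false | no a≢b   =
    trans (look-there M (removeσ xs σ) a≢b) (trans (look-kept xs σ p) (sym (look-there M σ a≢b)))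

  rangeσ-removeσ : ∀ xs σ {a} → a ∈ rangeσ (removeσ xs σ) → a ∈ rangeσ σ
  rangeσ-removeσ xs ((b , M) ∷ σ) p with not (memᵇ b xs)
  ... | false = ∈-++⁺ʳ (names M) (rangeσ-removeσ xs σ p)
  ... | true with ∈-++⁻ (names M) p
  ...   | inj₁ q = ∈-++⁺ˡ q
  ...   | inj₂ q = ∈-++⁺ʳ (names M) (rangeσ-removeσ xs σ q)

  upds-∈ : ∀ {V : Set} {ρ θ : Name → V} xs vs {a} → length vs ≡ length xs → a ∈ xs →
           upds ρ xs vs a ≡ upds θ xs vs a × upds ρ xs vs a ∈ vs
  upds-∈ {ρ = ρ} {θ} (x ∷ xs) (v ∷ vs) {a} len p with a ≟ x
  ... | yes refl = trans (upd-same (upds ρ xs vs) x v) (sym (upd-same (upds θ xs vs) x v))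
                 , subst (_∈ v ∷ vs) (sym (upd-same (upds ρ xs vs) x v)) (here refl)
  ... | no a≢x with p
  ...   | here e  = contradiction e a≢x
  ...   | there q = let e , i = upds-∈ {ρ = ρ} {θ} xs vs (suc-injective len) q in
      trans (upd-diff (upds ρ xs vs) x v a≢x) (trans e (sym (upd-diff (upds θ xs vs) x v a≢x)))
    , subst (_∈ v ∷ vs) (sym (upd-diff (upds ρ xs vs) x v a≢x)) (there i)

  sub-upds-∉ : ∀ ρ xs vs M → (∀ {b} → b ∈ names M → b ∉ xs) → sub (upds ρ xs vs) M ≡ sub ρ M
  sub-upds-∉ ρ xs vs M h = sub-ext M λ p → upds-∉ ρ xs vs (h p)

  -- The premise on `rangeσ σ` is the side condition of `s-ν` and `s-inp`: messages inserted by `σ`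
  -- mention no name of `xs`, so the update does not touch them.
  upds-look : ∀ ρ σ xs vs → length vs ≡ length xs → All (_∉ rangeσ σ) xs →
              ∀ a → sub (upds ρ xs vs) (look (removeσ xs σ) a) ≡ upds (sub ρ ∘ look σ) xs vs a
  upds-look ρ σ xs vs len av a with a ∈? xs
  ... | yes a∈ = trans (cong (sub (upds ρ xs vs)) (look-removed xs σ a∈)) (proj₁ (upds-∈ xs vs len a∈))
  ... | no a∉  = trans (cong (sub (upds ρ xs vs)) (look-kept xs σ a∉))
      (trans (sub-upds-∉ ρ xs vs (look σ a) apart) (sym (upds-∉ (sub ρ ∘ look σ) xs vs a∉)))
    where
    apart : ∀ {b} → b ∈ names (look σ a) → b ∉ xs
    apart p q with look-names σ p
    ... | inj₁ refl = a∉ q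
    ... | inj₂ r    = All.lookup av q r

  -- The mirror image of `upds-look`, with the environment applied before the substitution.
  -- Apartness from `zs` is asked only outside `xs`, since on `xs` the value of `θ` is overwritten.
  look-upds : ∀ σ θ xs zs → length zs ≡ length xs → ∀ {a} →
              (a ∉ xs → ∀ {b} → b ∈ names (θ a) → b ∉ zs) →
              sub (look (removeσ zs σ)) (upds θ xs (List.map name zs) a) ≡
              upds (sub (look σ) ∘ θ) xs (List.map name zs) a
  look-upds σ θ xs zs len {a} apart with a ∈? xs
  ... | no a∉  = trans (cong (sub (look (removeσ zs σ))) (upds-∉ θ xs _ a∉))
      (trans (sub-ext (θ a) (λ p → look-kept zs σ (apart a∉ p))) (sym (upds-∉ (sub (look σ) ∘ θ) xs _ a∉)))
  ... | yes a∈ with upds-∈ {ρ = θ} {sub (look σ) ∘ θ} xs (List.map name zs) (trans (length-map name zs) len) a∈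
  ...   | e , i with ∈-map⁻ name i
  ...     | b , b∈ , eb = trans (cong (sub (look (removeσ zs σ))) eb)
    (trans (look-removed zs σ b∈) (trans (sym eb) e))

  upds-upds : ∀ ρ θ xs zs vs → length zs ≡ length xs → length vs ≡ length xs → Unique zs → ∀ {a} →
              (a ∉ xs → ∀ {b} → b ∈ names (θ a) → b ∉ zs) →
              sub (upds ρ zs vs) (upds θ xs (List.map name zs) a) ≡ upds (sub ρ ∘ θ) xs vs a
  upds-upds ρ θ [] [] [] _ _ _ _ = refl
  upds-upds ρ θ (x ∷ xs) (z ∷ zs) (v ∷ vs) l l' (z∉ ∷ u) {a} apart with a ≟ x
  ... | yes refl = trans (cong (sub (upds ρ (z ∷ zs) (v ∷ vs))) (upd-same (upds θ xs (List.map name zs)) x (name z)))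
    (trans (upd-same (upds ρ zs vs) z v) (sym (upd-same (upds (sub ρ ∘ θ) xs vs) x v)))
  ... | no a≢x   = trans (cong (sub (upds ρ (z ∷ zs) (v ∷ vs))) (upd-diff (upds θ xs (List.map name zs)) x (name z) a≢x))
    (trans (sub-ext (upds θ xs (List.map name zs) a) (λ p → upd-diff (upds ρ zs vs) z v (λ { refl → z-apart p })))
    (trans (upds-upds ρ θ xs zs vs (suc-injective l) (suc-injective l') u (λ a∉ p → apart (λ { (here e) → a≢x e ; (there q) → a∉ q }) p ∘ there))
      (sym (upd-diff (upds (sub ρ ∘ θ) xs vs) x v a≢x))))
    where
    z-apart : z ∉ names (upds θ xs (List.map name zs) a)
    z-apart p with a ∈? xs
    ... | no a∉  = apart (λ { (here e) → a≢x e ; (there q) → a∉ q }) (subst (λ M → z ∈ names M) (upds-∉ θ xs _ a∉) p) (here refl)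
    ... | yes a∈ with ∈-map⁻ name (proj₂ (upds-∈ {ρ = θ} {θ} xs (List.map name zs) (trans (length-map name zs) (suc-injective l)) a∈))
    ...   | b , b∈ , e with subst (λ M → z ∈ names M) e p
    ...     | here refl = All.lookup z∉ b∈ refl

  -- Seen through canonical forms, capture-free substitution is composition of environments; the
  -- binder condition of `s-ν` is what makes updates commute with `look σ`.
  canonP-subst : ∀ {n ρ σ P R} → SubP σ P R → canonP n ρ R ≡ canonP n (sub ρ ∘ look σ) P
  canonP-subst s-𝟘 = refl
  canonP-subst {n} {ρ} {σ} (s-ν {x = x} {P} x∉ s) = cong (ν n) (trans (canonP-subst s)
    (canonP-ext P (λ {a} _ → upds-look ρ σ (x ∷ []) (name n ∷ []) refl (x∉ ∷ []) a)))
  canonP-subst (s-∥ s t) = cong₂ _∥_ (canonP-subst s) (canonP-subst t)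
  canonP-subst {ρ = ρ} {σ} (s-⟪⟫ {M = M})    = cong ⟪_⟫ (trans (cong (sub ρ) (substM-sub σ M)) (sub-sub ρ (look σ) M))
  canonP-subst {ρ = ρ} {σ} (s-call {Ms = Ms}) =
    cong (call _) (trans (cong (subV ρ) (substV-subV σ Ms)) (subV-subV ρ (look σ) Ms))

  canonA-subst : ∀ {n ρ σ A B} → SubA σ A B → canonA n ρ B ≡ canonA n (sub ρ ∘ look σ) A
  canonA-subst {n} {ρ} {σ} (s-out {N = N} ec s) = out-cong (cong (chan ∘ sub ρ) (sym ec))
    (trans (cong (sub ρ) (substM-sub σ N)) (sub-sub ρ (look σ) N)) (canonP-subst s)
  canonA-subst {n} {ρ} {σ} (s-inp {xs = xs} {N} {P} ec av s) = inp-cong (cong (chan ∘ sub ρ) (sym ec)) refl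
      (trans (cong (sub ρ') (substM-sub _ N)) (trans (sub-sub ρ' _ N) (sub-ext N (λ {a} _ → agree a))))
      (trans (canonP-subst s) (canonP-ext P (λ {a} _ → agree a)))
    where
    ρ'    = upds ρ xs (fresh n xs)
    agree = upds-look ρ σ xs (fresh n xs) (length-fresh n xs) av
  canonA-subst (s-⊕ s t) = cong₂ _⊕_ (canonA-subst s) (canonA-subst t)

  below-upds : ∀ {θ n} L xs → (∀ {a} → a ∈ remove xs L → Below n (names (θ a))) →
               ∀ {a} → a ∈ L → Below (length xs + n) (names (upds θ xs (fresh n xs) a))
  below-upds {θ} {n} L xs bd {a} p {b} q with a ∈? xs
  ... | no a∉  = ≤-trans (bd (∈-remove xs L p a∉) (subst (λ M → b ∈ names M) (upds-∉ θ xs _ a∉) q)) (m≤n+m n (length xs))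
  ... | yes a∈ with ∈-map⁻ name (proj₂ (upds-∈ {ρ = θ} {θ} xs (fresh n xs) (length-fresh n xs) a∈))
  ...   | c , c∈ , e with subst (λ M → b ∈ names M) e q
  ...     | here refl = ∈-block⇒< n (length xs) c∈

  ∉-block : ∀ {n a} m → a < n → a ∉ block n m
  ∉-block m a<n p = <-irrefl refl (≤-trans a<n (∈-block⇒≤ _ m p))

  -- The inner pass makes binders from `n` upwards, above every name in the relevant values of `θ`,
  -- so nothing is captured. With `name` for both environments and `n` above the free names of `P`,
  -- `canon⇒=α` then makes `canonP n name P` an α-variant of `P`.
  canonP-canonP : ∀ {m n ρ θ} P → (∀ {a} → a ∈ fnP P → Below n (names (θ a))) →
                  canonP m ρ (canonP n θ P) ≡ canonP m (sub ρ ∘ θ) P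
  canonP-canonP 𝟘 bd = refl
  canonP-canonP {m} {n} {ρ} {θ} (ν x P) bd = cong (ν m) (trans
    (canonP-canonP P (below-upds {θ} (fnP P) (x ∷ []) bd))
    (canonP-ext P agree))
    where
    agree : ∀ {a} → a ∈ fnP P → sub (upd ρ n (name m)) (upd θ x (name n) a) ≡ upd (sub ρ ∘ θ) x (name m) a
    agree p = upds-upds ρ θ (x ∷ []) (n ∷ []) (name m ∷ []) refl refl ([] ∷ [])
      (λ a∉ q → ∉-block 1 (bd (∈-fnP-ν x P p (a∉ ∘ here)) q))
  canonP-canonP (P ∥ Q) bd =
    cong₂ _∥_ (canonP-canonP P (bd ∘ ∈-++⁺ˡ)) (canonP-canonP Q (bd ∘ ∈-++⁺ʳ (fnP P)))
  canonP-canonP ⟪ M ⟫       bd = cong ⟪_⟫ (sub-sub _ _ M)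
  canonP-canonP (call q Ms) bd = cong (call q) (subV-subV _ _ Ms)

  -- On `P` itself the substitution may be blocked by capture. The canonical variant has all its
  -- binders at `n` or above, beyond the range of `σ`, so every side condition of `SubP` holds.
  substP-exists : ∀ {n σ θ} P → Below n (rangeσ σ) → (∀ {a} → a ∈ fnP P → Below n (names (θ a))) →
                  SubP σ (canonP n θ P) (canonP n (sub (look σ) ∘ θ) P)
  substP-exists 𝟘 bσ bd = s-𝟘
  substP-exists {n} {σ} {θ} (ν x P) bσ bd = s-ν (<-irrefl refl ∘ bσ)
    (subst (SubP _ _) (canonP-ext P agree)
      (substP-exists P (m<n⇒m<1+n ∘ bσ ∘ rangeσ-removeσ (n ∷ []) σ) (below-upds {θ} (fnP P) (x ∷ []) bd)))
    where
    agree : ∀ {a} → a ∈ fnP P →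
            sub (look (removeσ (n ∷ []) σ)) (upd θ x (name n) a) ≡ upd (sub (look σ) ∘ θ) x (name n) a
    agree p = look-upds σ θ (x ∷ []) (n ∷ []) refl
      (λ a∉ q → ∉-block 1 (bd (∈-fnP-ν x P p (a∉ ∘ here)) q))
  substP-exists (P ∥ Q) bσ bd =
    s-∥ (substP-exists P bσ (bd ∘ ∈-++⁺ˡ)) (substP-exists Q bσ (bd ∘ ∈-++⁺ʳ (fnP P)))
  substP-exists {σ = σ} {θ} ⟪ M ⟫ bσ bd =
    subst (λ N → SubP σ _ ⟪ N ⟫) (trans (substM-sub σ (sub θ M)) (sub-sub (look σ) θ M)) s-⟪⟫
  substP-exists {σ = σ} {θ} (call q Ms) bσ bd =
    subst (λ Ns → SubP σ _ (call q Ns)) (trans (substV-subV σ (subV θ Ms)) (subV-subV (look σ) θ Ms)) s-call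

  fnA⊆allA : ∀ {a} A → a ∈ fnA A → a ∈ allA A
  fnA⊆allA (out c M P) (here e) = here e
  fnA⊆allA (out c M P) (there p) with ∈-++⁻ (names M) p
  ... | inj₁ q = there (∈-++⁺ˡ q)
  ... | inj₂ q = there (∈-++⁺ʳ (names M) (fnP⊆allP P q))
  fnA⊆allA (inp c xs M P) (here e) = here e
  fnA⊆allA (inp c xs M P) (there p) with ∈-++⁻ (names M) (remove-⊆ xs (names M ++ fnP P) p)
  ... | inj₁ q = there (∈-++⁺ʳ xs (∈-++⁺ˡ q))
  ... | inj₂ q = there (∈-++⁺ʳ xs (∈-++⁺ʳ (names M) (fnP⊆allP P q)))
  fnA⊆allA (A ⊕ B) p with ∈-++⁻ (fnA A) p
  ... | inj₁ q = ∈-++⁺ˡ (fnA⊆allA A q)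
  ... | inj₂ q = ∈-++⁺ʳ (allA A) (fnA⊆allA B q)

  IsName : Msg → Set
  IsName M = Σ[ d ∈ Name ] (M ≡ name d)

  -- The part of the domain of `SubA` that concerns channels. Under this condition `chan` loses no
  -- information.
  ChannelsTo : (Name → Msg) → Act → Set
  ChannelsTo θ (out c M P)    = IsName (θ c)
  ChannelsTo θ (inp c xs M P) = IsName (θ c)
  ChannelsTo θ (A ⊕ B)        = ChannelsTo θ A × ChannelsTo θ B

  channels-name : ∀ A → ChannelsTo name A
  channels-name (out c M P)    = c , refl
  channels-name (inp c xs M P) = c , refl
  channels-name (A ⊕ B)        = channels-name A , channels-name B

  channels-map : ∀ {θ ρ} A → (∀ {c} → c ∈ fnA A → IsName (θ c) → IsName (ρ c)) → ChannelsTo θ A → ChannelsTo ρ A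
  channels-map (out c M P)    h = h (here refl)
  channels-map (inp c xs M P) h = h (here refl)
  channels-map (A ⊕ B)        h (a , b) = channels-map A (h ∘ ∈-++⁺ˡ) a , channels-map B (h ∘ ∈-++⁺ʳ (fnA A)) b

  channels-=α : ∀ {θ A B} → A =αA B → ChannelsTo θ B → ChannelsTo θ A
  channels-=α (αA-out _)                c = c
  channels-=α (αA-inp _ _ _ _ _ _ _ _)  c = c
  channels-=α (αA-⊕ p q)                (a , b) = channels-=α p a , channels-=α q b

  channels-subst : ∀ {σ A B} → SubA σ A B → ChannelsTo (look σ) A
  channels-subst (s-out e _)   = _ , e
  channels-subst (s-inp e _ _) = _ , e
  channels-subst (s-⊕ s t)     = channels-subst s , channels-subst t

  module _ {n : ℕ} {θ : Name → Msg} {M P} xs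
           (bd : ∀ {a} → a ∈ remove xs (names M ++ fnP P) → Below n (names (θ a))) where

    private
      θ' = upds θ xs (fresh n xs)
      bl = block n (length xs)

    inp-apart : ∀ {a} → a ∈ names M ++ fnP P → a ∉ xs → ∀ {b} → b ∈ names (θ a) → b ∉ bl
    inp-apart p a∉ q = ∉-block (length xs) (bd (∈-remove xs (names M ++ fnP P) p a∉) q)

    inp-agree-look : ∀ σ {a} → a ∈ names M ++ fnP P →
                     sub (look (removeσ bl σ)) (θ' a) ≡ upds (sub (look σ) ∘ θ) xs (fresh n xs) a
    inp-agree-look σ p = look-upds σ θ xs bl (length-block n (length xs)) (inp-apart p)

    inp-agree : ∀ ρ m {a} → a ∈ names M ++ fnP P →
                sub (upds ρ bl (fresh m xs)) (θ' a) ≡ upds (sub ρ ∘ θ) xs (fresh m xs) a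
    inp-agree ρ m p = upds-upds ρ θ xs bl (fresh m xs) (length-block n (length xs)) (length-fresh m xs)
      (block-unique n (length xs)) (inp-apart p)

  canonA-canonA : ∀ {m n ρ θ} A → ChannelsTo θ A → (∀ {a} → a ∈ fnA A → Below n (names (θ a))) →
                  canonA m ρ (canonA n θ A) ≡ canonA m (sub ρ ∘ θ) A
  canonA-canonA {ρ = ρ} {θ} (out c M P) (d , e) bd = out-cong
    (trans (cong (chan ∘ ρ ∘ chan) e) (cong (chan ∘ sub ρ) (sym e)))
    (sub-sub ρ θ M) (canonP-canonP P (bd ∘ there ∘ ∈-++⁺ʳ (names M)))
  canonA-canonA {m} {n} {ρ} {θ} (inp c xs M P) (d , e) bd rewrite length-block n (length xs) = inp-cong
    (trans (cong (chan ∘ ρ ∘ chan) e) (cong (chan ∘ sub ρ) (sym e))) refl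
    (trans (sub-sub _ _ M) (sub-ext M (agree ∘ ∈-++⁺ˡ)))
    (trans (canonP-canonP P (λ p → below-upds {θ} (names M ++ fnP P) xs (bd ∘ there) (∈-++⁺ʳ (names M) p)))
           (canonP-ext P (agree ∘ ∈-++⁺ʳ (names M))))
    where
    agree : ∀ {a} → a ∈ names M ++ fnP P →
            sub (upds ρ (block n (length xs)) (fresh m xs)) (upds θ xs (fresh n xs) a)
              ≡ upds (sub ρ ∘ θ) xs (fresh m xs) a
    agree = inp-agree {θ = θ} {M} {P} xs (bd ∘ there) ρ m
  canonA-canonA (A ⊕ B) (cA , cB) bd =
    cong₂ _⊕_ (canonA-canonA A cA (bd ∘ ∈-++⁺ˡ)) (canonA-canonA B cB (bd ∘ ∈-++⁺ʳ (fnA A)))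

  substA-exists : ∀ {n σ} A → ChannelsTo (look σ) A → Below n (rangeσ σ) → Below n (fnA A) →
                  SubA σ (canonA n name A) (canonA n (look σ) A)
  substA-exists {n} {σ} (out c M P) (d , e) bσ bA
    rewrite e | sym (trans (substM-sub σ (sub name M)) (sub-sub (look σ) name M)) =
    s-out e (substP-exists P bσ (λ { p (here refl) → bA (there (∈-++⁺ʳ (names M) p)) }))
  substA-exists {n} {σ} (inp c xs M P) (d , e) bσ bA =
    subst (SubA σ _) (inp-cong (cong chan (sym e)) refl
      (trans (substM-sub _ (sub θ' M)) (trans (sub-sub _ _ M) (sub-ext M (agree ∘ ∈-++⁺ˡ))))
      (canonP-ext P (agree ∘ ∈-++⁺ʳ (names M))))
      (s-inp e (All.tabulate (λ z∈ p → ∉-block (length xs) (bσ p) z∈))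
        (substP-exists P (λ p → ≤-trans (bσ (rangeσ-removeσ bl σ p)) (m≤n+m n (length xs)))
          (λ p → below-upds {name} (names M ++ fnP P) xs bd (∈-++⁺ʳ (names M) p))))
    where
    bl = block n (length xs)
    θ' = upds name xs (fresh n xs)
    bd : ∀ {a} → a ∈ remove xs (names M ++ fnP P) → Below n (names (name a))
    bd p (here refl) = bA (there p)
    agree : ∀ {a} → a ∈ names M ++ fnP P →
            sub (look (removeσ bl σ)) (θ' a) ≡ upds (look σ) xs (fresh n xs) a
    agree = inp-agree-look {θ = name} {M} {P} xs bd σ
  substA-exists (A ⊕ B) (cA , cB) bσ bA =
    s-⊕ (substA-exists A cA bσ (bA ∘ ∈-++⁺ˡ)) (substA-exists B cB bσ (bA ∘ ∈-++⁺ʳ (fnA A)))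

  below-look : ∀ {n} σ {a} → a < n → Below n (rangeσ σ) → Below n (names (look σ a))
  below-look σ a<n bσ p with look-names σ p
  ... | inj₁ refl = a<n
  ... | inj₂ q    = bσ q

  -- Instances of definitions and patterns under injective renaming

  -- `A` plays the body of a definition, which must stay fixed while the arguments are renamed. The
  -- new instance is therefore rebuilt from a canonical variant of `A`, at a level above `A` and the
  -- range of `σ'`, and compared with `renA π A₁` by canonical forms.
  substA-ren : ∀ {A A₀ A₁ σ σ'} π → Injective _≡_ _≡_ π → A =αA A₀ → SubA σ A₀ A₁ →
               (∀ {a} → a ∈ fnA A → look σ' a ≡ rename π (look σ a)) →
               Σ[ A₀' ∈ Act ] Σ[ A₁' ∈ Act ] (A =αA A₀' × SubA σ' A₀' A₁' × renA π A₁ =αA A₁')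
  substA-ren {A} {A₀} {A₁} {σ} {σ'} π inj α s h =
    canonA n name A , canonA n (look σ') A
    , canon⇒=αA (λ m → sym (canonA-canonA A (channels-name A) λ { p (here refl) → bA p }))
    , substA-exists A ch bσ bA
    , canon⇒=αA (λ m → begin
        canonA m name (renA π A₁)                ≡⟨ canonA-ren π A₁ inj ⟩
        canonA m (name ∘ π) A₁                   ≡⟨ canonA-subst s ⟩
        canonA m (sub (name ∘ π) ∘ look σ) A₀    ≡⟨ canonA-sound α ⟨
        canonA m (sub (name ∘ π) ∘ look σ) A     ≡⟨ canonA-ext A (λ {a} p → agree p) ⟩
        canonA m (sub name ∘ look σ') A          ≡⟨ canonA-canonA A ch (λ p → below-look σ' (bA p) bσ) ⟨
        canonA m name (canonA n (look σ') A)     ∎)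
    where
    open ≡-Reasoning
    n = bound (allA A ++ rangeσ σ')
    bA : Below n (fnA A)
    bA p = ∈⇒<bound (∈-++⁺ˡ (fnA⊆allA A p))
    bσ : Below n (rangeσ σ')
    bσ p = ∈⇒<bound (∈-++⁺ʳ (allA A) p)
    -- The given instance shows that `σ` maps the channels of `A₀`, which are those of `A`, to
    -- names; `h` carries this over to `σ'`.
    ch : ChannelsTo (look σ') A
    ch = channels-map A (λ { p (d , e) → π d , trans (h p) (cong (rename π) e) })
           (channels-=α α (channels-subst s))
    agree : ∀ {a} → a ∈ fnA A → sub (name ∘ π) (look σ a) ≡ sub name (look σ' a)
    agree {a} p = trans (sym (rename-sub π (look σ a))) (trans (sym (h p)) (sym (sub-name _)))

  -- In contrast to `substA-ren`, the process is renamed too, pattern variables included, since a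
  -- continuation contains names of its surroundings. The result comes from a canonical variant,
  -- hence agrees with `renP π R` only up to `=α`.
  ≔-ren : ∀ {P R σ σ'} π → Injective _≡_ _≡_ π → P [ σ ]≔ R →
          (∀ a → look σ' (π a) ≡ rename π (look σ a)) →
          Σ[ R' ∈ Proc ] (renP π P [ σ' ]≔ R' × R' =α renP π R)
  ≔-ren {P} {R} {σ} {σ'} π inj (P₀ , α , s) h =
    canonP n (look σ') πP
    , (canonP n name πP
      , canon⇒=α (λ m → sym (canonP-canonP πP λ { p (here refl) → bP p }))
      , substP-exists πP bσ (λ { p (here refl) → bP p }))
    , canon⇒=α (λ m → begin
        canonP m name (canonP n (look σ') πP)    ≡⟨ canonP-canonP πP (λ p → below-look σ' (bP p) bσ) ⟩
        canonP m (sub name ∘ look σ') πP         ≡⟨ canonP-ren π P (λ _ _ → inj) ⟩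
        canonP m (sub name ∘ look σ' ∘ π) P      ≡⟨ canonP-ext P (λ {a} _ → agree a) ⟩
        canonP m (sub (name ∘ π) ∘ look σ) P     ≡⟨ canonP-sound α ⟩
        canonP m (sub (name ∘ π) ∘ look σ) P₀    ≡⟨ canonP-subst s ⟨
        canonP m (name ∘ π) R                    ≡⟨ canonP-ren π R (λ _ _ → inj) ⟨
        canonP m name (renP π R)                 ∎)
    where
    open ≡-Reasoning
    πP = renP π P
    n = bound (allP πP ++ rangeσ σ')
    bP : Below n (fnP πP)
    bP p = ∈⇒<bound (∈-++⁺ˡ (fnP⊆allP πP p))
    bσ : Below n (rangeσ σ')
    bσ p = ∈⇒<bound (∈-++⁺ʳ (allP πP) p)
    agree : ∀ a → sub name (look σ' (π a)) ≡ sub (name ∘ π) (look σ a)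
    agree a = trans (sub-name _) (trans (h a) (rename-sub π (look σ a)))

  -- Parameters stay and arguments are renamed. Outside `ps`, `look` returns the name itself, so the
  -- equation would require `π a ≡ a`.
  look-zip-ren : ∀ {n} π (ps : Vec Name n) Ms {a} → a ∈ Vec.toList ps →
                 look (zipσ ps (renameV π Ms)) a ≡ rename π (look (zipσ ps Ms) a)
  look-zip-ren π (p ∷ ps) (M ∷ Ms) {a} a∈ with a ≟ p | a∈
  ... | yes refl | _ =
    trans (look-here p _ (zipσ ps (renameV π Ms))) (cong (rename π) (sym (look-here p M (zipσ ps Ms))))
  ... | no a≢p | here e  = contradiction e a≢p
  ... | no a≢p | there q = trans (look-there _ (zipσ ps (renameV π Ms)) a≢p)
    (trans (look-zip-ren π ps Ms q) (cong (rename π) (sym (look-there M (zipσ ps Ms) a≢p))))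

  -- This is `renameV` reindexed: the lengths of `xs` and `List.map π xs` agree only
  -- propositionally.
  renArgs : ∀ π (xs : List Name) → Vec Msg (length xs) → Vec Msg (length (List.map π xs))
  renArgs π []       []       = []
  renArgs π (x ∷ xs) (M ∷ Ms) = rename π M ∷ renArgs π xs Ms

  look-args-ren : ∀ π → Injective _≡_ _≡_ π → ∀ xs Ms a →
                  look (zipσ (Vec.fromList (List.map π xs)) (renArgs π xs Ms)) (π a)
                    ≡ rename π (look (zipσ (Vec.fromList xs) Ms) a)
  look-args-ren π inj []       []       a = refl
  look-args-ren π inj (x ∷ xs) (M ∷ Ms) a with a ≟ x
  ... | yes refl = trans (look-here (π x) _ (zipσ (Vec.fromList (List.map π xs)) (renArgs π xs Ms)))
    (cong (rename π) (sym (look-here x M (zipσ (Vec.fromList xs) Ms))))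
  ... | no a≢x   = trans (look-there _ (zipσ (Vec.fromList (List.map π xs)) (renArgs π xs Ms)) (a≢x ∘ inj))
    (trans (look-args-ren π inj xs Ms a)
      (cong (rename π) (sym (look-there M (zipσ (Vec.fromList xs) Ms) a≢x))))

  substM-args-ren : ∀ π → Injective _≡_ _≡_ π → ∀ xs Ms N →
                    substM (zipσ (Vec.fromList (List.map π xs)) (renArgs π xs Ms)) (rename π N)
                      ≡ rename π (substM (zipσ (Vec.fromList xs) Ms) N)
  substM-args-ren π inj xs Ms N = begin
    substM σ' (rename π N)                ≡⟨ substM-sub σ' (rename π N) ⟩
    sub (look σ') (rename π N)            ≡⟨ sub-rename (look σ') π N ⟩
    sub (look σ' ∘ π) N                   ≡⟨ sub-ext N (λ {a} _ → trans (look-args-ren π inj xs Ms a) (rename-sub π _)) ⟩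
    sub (sub (name ∘ π) ∘ look σ) N       ≡⟨ sub-sub (name ∘ π) (look σ) N ⟨
    sub (name ∘ π) (sub (look σ) N)       ≡⟨ rename-sub π _ ⟨
    rename π (sub (look σ) N)             ≡⟨ cong (rename π) (substM-sub σ N) ⟨
    rename π (substM σ N)                 ∎
    where
    open ≡-Reasoning
    σ  = zipσ (Vec.fromList xs) Ms
    σ' = zipσ (Vec.fromList (List.map π xs)) (renArgs π xs Ms)

  -- Openings

  -- When `L` contains the names of a process and `zs` is the pool, this says that names from the
  -- pool can replace binders without capturing or identifying anything.
  record Good (ρ : Name → Name) (L zs : List Name) : Set where
    constructor good
    field
      inj   : InjOn L ρ
      apart : ∀ {a} → a ∈ L → ρ a ∉ zs
      uniq  : Unique zs

  open Good

  good-↭ : ∀ {ρ L zs ws} → zs ↭ ws → Good ρ L zs → Good ρ L ws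
  good-↭ p (good i a u) = good i (λ a∈ → a a∈ ∘ ∈-resp-↭ (↭-sym p)) (Unique-resp-↭ (↭⇒↭ₛ p) u)

  good-⊆ : ∀ {ρ L L' zs} → L ⊆ L' → Good ρ L' zs → Good ρ L zs
  good-⊆ s (good i a u) = good (λ p q → i (s p) (s q)) (a ∘ s) u

  good-tail : ∀ {ρ L z zs} → Good ρ L (z ∷ zs) → Good ρ L zs
  good-tail (good i a (_ ∷ u)) = good i (λ p → a p ∘ there) u

  good-++ʳ : ∀ {ρ L} zs {ws} → Good ρ L (zs ++ ws) → Good ρ L ws
  good-++ʳ []       g = g
  good-++ʳ (z ∷ zs) g = good-++ʳ zs (good-tail g)

  good-++ˡ : ∀ {ρ L} zs {ws} → Good ρ L (zs ++ ws) → Good ρ L zs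
  good-++ˡ zs {ws} g = good-++ʳ ws (good-↭ (++-comm zs ws) g)

  -- The invariant for passing under a restriction: as a pool name, `z` is no value of `ρ` on `L`,
  -- and as the pool has no duplicates, it does not occur in the remaining pool.
  good-upd : ∀ {ρ L z zs} x → Good ρ L (z ∷ zs) → Good (upd ρ x z) L zs
  good-upd {ρ} {L} {z} {zs} x (good i ap (z∉ ∷ u)) = good i' ap' u
    where
    i' : InjOn L (upd ρ x z)
    i' {a} {b} p q e with a ≟ x | b ≟ x
    ... | yes refl | yes refl = refl
    ... | yes refl | no b≢x = contradiction (here (trans (sym (upd-diff ρ x z b≢x)) (trans (sym e) (upd-same ρ x z)))) (ap q)
    ... | no a≢x | yes refl = contradiction (here (trans (sym (upd-diff ρ x z a≢x)) (trans e (upd-same ρ x z)))) (ap p)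
    ... | no a≢x | no b≢x = i p q (trans (sym (upd-diff ρ x z a≢x)) (trans e (upd-diff ρ x z b≢x)))
    ap' : ∀ {a} → a ∈ L → upd ρ x z a ∉ zs
    ap' {a} p q with a ≟ x
    ... | yes refl = All.lookup z∉ (subst (_∈ zs) (upd-same ρ x z) q) refl
    ... | no a≢x   = ap p (there (subst (_∈ zs) (upd-diff ρ x z a≢x) q))

  ν-rebind : ∀ {ρ L z zs} x P → allP (ν x P) ⊆ L → Good ρ L (z ∷ zs) →
             renP ρ (ν x P) =α ν z (renP (upd ρ x z) P)
  ν-rebind {ρ} {L} {z} x P sub g = canon⇒=α λ n → cong (ν n)
    (trans (canonP-ren ρ P (λ p q → inj g (sub (there p)) (sub (there q))))
    (trans (canonP-ext P (agree n))
      (sym (canonP-ren (upd ρ x z) P (λ p q → inj (good-upd x g) (sub (there p)) (sub (there q)))))))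
    where
    agree : ∀ n {a} → a ∈ fnP P → upd name (ρ x) (name n) (ρ a) ≡ upd name z (name n) (upd ρ x z a)
    agree n {a} p with a ≟ x
    ... | yes refl = trans (upd-same name (ρ a) (name n))
      (sym (trans (cong (upd name z (name n)) (upd-same ρ a z)) (upd-same name z (name n))))
    ... | no a≢x = trans (upd-diff name (ρ x) (name n) (a≢x ∘ inj g a∈ (sub (here refl))))
      (sym (trans (cong (upd name z (name n)) (upd-diff ρ x z a≢x))
                  (upd-diff name z (name n) (apart g a∈ ∘ here))))
      where a∈ = sub (there (fnP⊆allP P p))

  nus-++ : ∀ zs ws P → nus (zs ++ ws) P ≡ nus zs (nus ws P)
  nus-++ []       ws P = refl
  nus-++ (z ∷ zs) ws P = cong (ν z) (nus-++ zs ws P)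

  nus-cong : ∀ zs {P Q} → P ≡ₛ Q → nus zs P ≡ₛ nus zs Q
  nus-cong []       p = p
  nus-cong (z ∷ zs) p = ≡-ν (nus-cong zs p)

  nus-↭ : ∀ {zs ws P} → zs ↭ ws → nus zs P ≡ₛ nus ws P
  nus-↭ ↭.refl         = ≡-refl
  nus-↭ (↭.prep z p)   = ≡-ν (nus-↭ p)
  nus-↭ (↭.swap z w p) = ≡-trans ≡-νν (≡-ν (≡-ν (nus-↭ p)))
  nus-↭ (↭.trans p q)  = ≡-trans (nus-↭ p) (nus-↭ q)

  fnP-nus : ∀ {a} zs P → a ∈ fnP (nus zs P) → a ∈ fnP P
  fnP-nus []       P p = p
  fnP-nus (z ∷ zs) P p = fnP-nus zs P (remove-⊆ (z ∷ []) (fnP (nus zs P)) p)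

  -- An idle restriction is introduced as `ν z 𝟘` beside the process and then extruded.
  nus-junk : ∀ zs {P} → (∀ {z} → z ∈ zs → z ∉ fnP P) → P ≡ₛ nus zs P
  nus-junk []       h = ≡-refl
  nus-junk (z ∷ zs) {P} h = ≡-trans (nus-junk zs (h ∘ there)) (≡-trans (≡-sym ≡-unit)
    (≡-trans (≡-∥ ≡-refl (≡-sym ≡-ν𝟘)) (≡-trans (≡-extr (h (here refl) ∘ fnP-nus zs P)) (≡-ν ≡-unit))))

  nus-extrʳ : ∀ zs {P Q} → (∀ {z} → z ∈ zs → z ∉ fnP P) → (P ∥ nus zs Q) ≡ₛ nus zs (P ∥ Q)
  nus-extrʳ []       h = ≡-refl
  nus-extrʳ (z ∷ zs) h = ≡-trans (≡-extr (h (here refl))) (≡-ν (nus-extrʳ zs (h ∘ there)))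

  nus-extrˡ : ∀ zs {P Q} → (∀ {z} → z ∈ zs → z ∉ fnP Q) → (nus zs P ∥ Q) ≡ₛ nus zs (P ∥ Q)
  nus-extrˡ zs h = ≡-trans ≡-comm (≡-trans (nus-extrʳ zs h) (nus-cong zs ≡-comm))

  ∥-swap : ∀ {P Q R} → (P ∥ Q ∥ R) ≡ₛ (Q ∥ P ∥ R)
  ∥-swap = ≡-trans (≡-sym ≡-assoc) (≡-trans (≡-∥ ≡-comm ≡-refl) ≡-assoc)

  -- Open ρ P zs T: T is P renamed by ρ, with its restrictions removed and the
  -- restricted names replaced by names from the pool zs; names of the pool may
  -- be left over, which absorbs the law ν a.0 ≡ 0.
  data Open : (Name → Name) → Proc → List Name → Proc → Set where
    o-𝟘    : ∀ {ρ zs} → Open ρ 𝟘 zs 𝟘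
    o-⟪⟫   : ∀ {ρ zs M} → Open ρ ⟪ M ⟫ zs ⟪ rename ρ M ⟫
    o-call : ∀ {ρ zs q Ms} → Open ρ (call q Ms) zs (call q (renameV ρ Ms))
    o-∥    : ∀ {ρ zs us vs P Q T U} → zs ↭ us ++ vs →
             Open ρ P us T → Open ρ Q vs U → Open ρ (P ∥ Q) zs (T ∥ U)
    o-ν    : ∀ {ρ zs ws x P T} z → zs ↭ z ∷ ws → Open (upd ρ x z) P ws T → Open ρ (ν x P) zs T

  open-↭ : ∀ {ρ P zs ws T} → zs ↭ ws → Open ρ P zs T → Open ρ P ws T
  open-↭ p o-𝟘         = o-𝟘
  open-↭ p o-⟪⟫        = o-⟪⟫
  open-↭ p o-call      = o-call
  open-↭ p (o-∥ q o r) = o-∥ (↭-trans (↭-sym p) q) o r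
  open-↭ p (o-ν z q o) = o-ν z (↭-trans (↭-sym p) q) o

  open-weaken : ∀ {ρ P zs T} js → Open ρ P zs T → Open ρ P (js ++ zs) T
  open-weaken js o-𝟘    = o-𝟘
  open-weaken js o-⟪⟫   = o-⟪⟫
  open-weaken js o-call = o-call
  open-weaken js (o-∥ {us = us} {vs} p o r) =
    o-∥ (↭-trans (++⁺ˡ js p) (↭-sym (↭-assoc js us vs))) (open-weaken js o) r
  open-weaken js (o-ν {ws = ws} z p o) =
    o-ν z (↭-trans (++⁺ˡ js p) (shift z js ws)) (open-weaken js o)

  open-ext : ∀ {ρ θ P zs T} → (∀ {a} → a ∈ fnP P → ρ a ≡ θ a) → Open ρ P zs T → Open θ P zs T
  open-ext h o-𝟘 = o-𝟘
  open-ext h (o-⟪⟫ {M = M}) = subst (λ N → Open _ ⟪ M ⟫ _ ⟪ N ⟫) (sym (rename-ext M h)) o-⟪⟫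
  open-ext h (o-call {q = q} {Ms}) =
    subst (λ Ns → Open _ (call q Ms) _ (call q Ns)) (sym (renameV-ext Ms h)) o-call
  open-ext h (o-∥ {P = P} p o r) = o-∥ p (open-ext (h ∘ ∈-++⁺ˡ) o) (open-ext (h ∘ ∈-++⁺ʳ (fnP P)) r)
  open-ext h (o-ν {x = x} {P} z p o) = o-ν z p (open-ext (upd-cong-fn x z P h) o)

  open-ren⁺ : ∀ {ρ zs T} π P → Injective _≡_ _≡_ π → Open (ρ ∘ π) P zs T → Open ρ (renP π P) zs T
  open-ren⁺ π 𝟘 i o-𝟘 = o-𝟘
  open-ren⁺ {ρ} π ⟪ M ⟫ i o-⟪⟫ = subst (λ N → Open _ _ _ ⟪ N ⟫) (rename-∘ ρ π M) o-⟪⟫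
  open-ren⁺ {ρ} π (call q Ms) i o-call = subst (λ Ns → Open _ _ _ (call q Ns)) (renameV-∘ ρ π Ms) o-call
  open-ren⁺ π (P ∥ Q) i (o-∥ p o r) = o-∥ p (open-ren⁺ π P i o) (open-ren⁺ π Q i r)
  open-ren⁺ {ρ} π (ν x P) i (o-ν z p o) = o-ν z p (open-ren⁺ π P i
    (open-ext (λ {a} _ → sym (upds-∘ ρ π (x ∷ []) (z ∷ []) i a)) o))

  open-ren⁻ : ∀ {ρ zs T} π P → Injective _≡_ _≡_ π → Open ρ (renP π P) zs T → Open (ρ ∘ π) P zs T
  open-ren⁻ π 𝟘 i o-𝟘 = o-𝟘
  open-ren⁻ {ρ} π ⟪ M ⟫ i o-⟪⟫ = subst (λ N → Open _ _ _ ⟪ N ⟫) (sym (rename-∘ ρ π M)) o-⟪⟫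
  open-ren⁻ {ρ} π (call q Ms) i o-call = subst (λ Ns → Open _ _ _ (call q Ns)) (sym (renameV-∘ ρ π Ms)) o-call
  open-ren⁻ π (P ∥ Q) i (o-∥ p o r) = o-∥ p (open-ren⁻ π P i o) (open-ren⁻ π Q i r)
  open-ren⁻ {ρ} π (ν x P) i (o-ν z p o) = o-ν z p
    (open-ext (λ {a} _ → upds-∘ ρ π (x ∷ []) (z ∷ []) i a) (open-ren⁻ π P i o))

  upd-sw : ∀ {V : Set} (ρ : Name → V) x y v {a} → a ≢ y → upd ρ x v a ≡ upd ρ y v (sw x y a)
  upd-sw ρ x y v {a} a≢y with a ≟ x
  ... | yes refl = trans (upd-same ρ x v) (sym (trans (cong (upd ρ y v) (sw-left x y)) (upd-same ρ y v)))
  ... | no a≢x   = trans (upd-diff ρ x v a≢x)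
    (sym (trans (cong (upd ρ y v) (sw-other a≢x a≢y)) (upd-diff ρ y v a≢y)))

  open-α : ∀ {ρ P Q zs T} → P =α Q → Open ρ P zs T → Open ρ Q zs T
  open-α α-𝟘       o           = o
  open-α α-⟪⟫      o           = o
  open-α α-call    o           = o
  open-α (α-∥ p q) (o-∥ e o r) = o-∥ e (open-α p o) (open-α q r)
  -- The binder `x` is swapped to the common fresh name `w`, which takes over the value `z`; the
  -- hypothesis converts the swapped bodies, and the swap of `y` with `w` is undone. The opened
  -- process itself never changes.
  open-α {ρ} (α-ν {x} {y} {P} {Q} w w∉P w∉Q α) (o-ν z p o) = o-ν z p
    (open-ext (λ {a} a∈ → sym (upd-sw ρ y w z (λ { refl → w∉Q (there (fnP⊆allP Q a∈)) })))
      (open-ren⁻ {upd ρ w z} (sw y w) Q (sw-injective y w) (subst (λ R → Open _ R _ _) (swapP-renP y w Q)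
        (open-α α (subst (λ R → Open _ R _ _) (sym (swapP-renP x w P))
          (open-ren⁺ (sw x w) P (sw-injective x w)
            (open-ext (λ {a} a∈ → upd-sw ρ x w z (λ { refl → w∉P (there (fnP⊆allP P a∈)) })) o)))))))

  =α-sym : ∀ {P Q} → P =α Q → Q =α P
  =α-sym p = canon⇒=α λ n → sym (canonP-sound p)

  open-fn : ∀ {ρ P zs T a} → Open ρ P zs T → a ∈ fnP T → (Σ[ b ∈ Name ] (b ∈ fnP P × a ≡ ρ b)) ⊎ a ∈ zs
  open-fn {ρ} (o-⟪⟫ {M = M})    p = inj₁ (names-rename ρ M p)
  open-fn {ρ} (o-call {Ms = Ms}) p = inj₁ (namesV-renameV ρ Ms p)
  open-fn (o-∥ {us = us} {P = P} {T = T} e o r) p with ∈-++⁻ (fnP T) p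
  ... | inj₁ q with open-fn o q
  ...   | inj₁ (b , b∈ , eb) = inj₁ (b , ∈-++⁺ˡ b∈ , eb)
  ...   | inj₂ m             = inj₂ (∈-resp-↭ (↭-sym e) (∈-++⁺ˡ m))
  open-fn (o-∥ {us = us} {P = P} {T = T} e o r) p | inj₂ q with open-fn r q
  ...   | inj₁ (b , b∈ , eb) = inj₁ (b , ∈-++⁺ʳ (fnP P) b∈ , eb)
  ...   | inj₂ m             = inj₂ (∈-resp-↭ (↭-sym e) (∈-++⁺ʳ us m))
  open-fn {ρ} (o-ν {x = x} {P} z e o) p with open-fn o p
  ... | inj₂ m = inj₂ (∈-resp-↭ (↭-sym e) (there m))
  ... | inj₁ (b , b∈ , eb) with b ≟ x
  ...   | yes refl = inj₂ (∈-resp-↭ (↭-sym e) (here (trans eb (upd-same ρ x z))))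
  ...   | no b≢x   = inj₁ (b , ∈-fnP-ν x P b∈ b≢x , trans eb (upd-diff ρ x z b≢x))

  open-apart : ∀ {ρ L P us T z ws} → allP P ⊆ L → Good ρ L (us ++ ws) → Open ρ P us T → z ∈ ws → z ∉ fnP T
  open-apart {P = P} {us} sub g o z∈ p with open-fn o p
  ... | inj₁ (b , b∈ , refl) = apart g (sub (fnP⊆allP P b∈)) (∈-++⁺ʳ us z∈)
  ... | inj₂ m               = unique-disjoint us (uniq g) m z∈

  -- Parallel components use disjoint parts of the pool, so their restrictions extrude over each
  -- other; surplus pool names become idle restrictions.
  open-sound : ∀ {ρ L P zs T} → allP P ⊆ L → Good ρ L zs → Open ρ P zs T → renP ρ P ≡ₛ nus zs T
  open-sound {zs = zs} sub g o-𝟘 = nus-junk zs λ _ ()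
  open-sound {ρ} sub g (o-⟪⟫ {M = M}) = nus-junk _ λ z∈ p →
    let b , b∈ , e = names-rename ρ M p in apart g (sub b∈) (subst (_∈ _) e z∈)
  open-sound {ρ} sub g (o-call {Ms = Ms}) = nus-junk _ λ z∈ p →
    let b , b∈ , e = namesV-renameV ρ Ms p in apart g (sub b∈) (subst (_∈ _) e z∈)
  open-sound {L = L} {zs = zs} sub g (o-∥ {us = us} {vs} {P} {Q} {T} {U} e o r) =
    ≡-trans (≡-∥ (open-sound subP (good-++ˡ us g') o) (open-sound subQ (good-++ʳ us g') r))
    (≡-trans (nus-extrˡ us (λ z∈ → open-apart subQ (good-↭ (++-comm us vs) g') r z∈ ∘ fnP-nus vs U))
    (≡-trans (nus-cong us (nus-extrʳ vs (open-apart subP g' o)))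
    (subst (_≡ₛ nus zs (T ∥ U)) (nus-++ us vs (T ∥ U)) (nus-↭ (↭-sym e)))))
    where
    g' = good-↭ e g
    subP : allP P ⊆ L
    subP = sub ∘ ∈-++⁺ˡ
    subQ : allP Q ⊆ L
    subQ = sub ∘ ∈-++⁺ʳ (allP P)
  open-sound sub g (o-ν {x = x} {P} z e o) = ≡-trans (≡-α (ν-rebind x P sub g'))
    (≡-trans (≡-ν (open-sound (sub ∘ there) (good-upd x g') o)) (nus-↭ (↭-sym e)))
    where g' = good-↭ e g

  split-length : ∀ (zs : List Name) m {n} → length zs ≡ m + n →
                 Σ[ us ∈ List Name ] Σ[ vs ∈ List Name ] (zs ≡ us ++ vs × length us ≡ m × length vs ≡ n)
  split-length zs       zero    e = [] , zs , refl , refl , e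
  split-length (z ∷ zs) (suc m) e =
    let us , vs , e' , l , l' = split-length zs m (suc-injective e) in
    z ∷ us , vs , cong (z ∷_) e' , cong suc l , l'

  #ν : Proc → ℕ
  #ν 𝟘          = 0
  #ν ⟪ _ ⟫      = 0
  #ν (call _ _) = 0
  #ν (P ∥ Q)    = #ν P + #ν Q
  #ν (ν _ P)    = suc (#ν P)

  open-exists : ∀ {ρ} P zs → length zs ≡ #ν P → ∃ (Open ρ P zs)
  open-exists 𝟘           zs e = _ , o-𝟘
  open-exists ⟪ M ⟫       zs e = _ , o-⟪⟫
  open-exists (call q Ms) zs e = _ , o-call
  open-exists (P ∥ Q)     zs e =
    let us , vs , e' , l , l' = split-length zs (#ν P) e
        T , o = open-exists P us l
        U , r = open-exists Q vs l'
    in T ∥ U , o-∥ (↭-reflexive e') o r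
  open-exists (ν x P) (z ∷ zs) e = let T , o = open-exists P zs (suc-injective e) in T , o-ν z ↭-refl o

  data Flat : Proc → Set where
    f-𝟘    : Flat 𝟘
    f-⟪⟫   : ∀ {M} → Flat ⟪ M ⟫
    f-call : ∀ {q Ms} → Flat (call q Ms)
    f-∥    : ∀ {P Q} → Flat P → Flat Q → Flat (P ∥ Q)

  flat-⟨⟩ : ∀ Γ → Flat ⟨ Γ ⟩
  flat-⟨⟩ []      = f-𝟘
  flat-⟨⟩ (M ∷ Γ) = f-∥ f-⟪⟫ (flat-⟨⟩ Γ)

  open-flat : ∀ {ρ P zs} → Flat P → Open ρ P zs (renP ρ P)
  open-flat f-𝟘       = o-𝟘
  open-flat f-⟪⟫      = o-⟪⟫
  open-flat f-call    = o-call
  open-flat {zs = zs} (f-∥ f g) = o-∥ {us = zs} (↭-reflexive (sym (++-identityʳ zs))) (open-flat f) (open-flat g)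

  open-flat⁻ : ∀ {ρ P zs T} → Flat P → Open ρ P zs T → T ≡ renP ρ P
  open-flat⁻ f-𝟘       o-𝟘         = refl
  open-flat⁻ f-⟪⟫      o-⟪⟫        = refl
  open-flat⁻ f-call    o-call      = refl
  open-flat⁻ (f-∥ f g) (o-∥ _ o r) = cong₂ _∥_ (open-flat⁻ f o) (open-flat⁻ g r)

  renP-⟨⟩ : ∀ ρ Γ → renP ρ ⟨ Γ ⟩ ≡ ⟨ List.map (rename ρ) Γ ⟩
  renP-⟨⟩ ρ []      = refl
  renP-⟨⟩ ρ (M ∷ Γ) = cong (⟪ rename ρ M ⟫ ∥_) (renP-⟨⟩ ρ Γ)

  -- Deducibility under renaming

  module _ (IM : IntruderModel) (Δ : Definitions) where
    open Semantics IM Δ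
    open IntruderModel IM

    ⊢-∈ : ∀ {Γ M} → M ∈ Γ → Γ ⊢ M
    ⊢-∈ {M = M} p = ⊢-mono (λ { (here refl) → p }) (⊢-ax M)

    ⊢-cuts : ∀ Γ {Γ' M} → (∀ {N} → N ∈ Γ → Γ' ⊢ N) → (Γ ++ Γ') ⊢ M → Γ' ⊢ M
    ⊢-cuts []      h d = d
    ⊢-cuts (N ∷ Γ) h d =
      ⊢-cuts Γ (h ∘ there) (⊢-cut (⊢-mono (∈-++⁺ʳ Γ) (h (here refl))) d)

    ⪯-intro : ∀ {Γ Γ'} → (∀ {N} → N ∈ Γ → Γ' ⊢ N) → Γ ⪯ Γ'
    ⪯-intro {Γ} h M d = ⊢-cuts Γ h (⊢-mono ∈-++⁺ˡ d)

    ⪯-++ : ∀ {Γ₁ Γ₁' Γ₂ Γ₂'} → Γ₁ ⪯ Γ₁' → Γ₂ ⪯ Γ₂' → (Γ₁ ++ Γ₂) ⪯ (Γ₁' ++ Γ₂')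
    ⪯-++ {Γ₁} {Γ₁'} h h' = ⪯-intro λ p → [ (λ q → ⊢-mono ∈-++⁺ˡ (h _ (⊢-∈ q)))
                                         , (λ q → ⊢-mono (∈-++⁺ʳ Γ₁') (h' _ (⊢-∈ q))) ]′ (∈-++⁻ Γ₁ p)

    ⪯-ren : ∀ {Γ Γ'} π → Injective _≡_ _≡_ π → Γ ⪯ Γ' → List.map (rename π) Γ ⪯ List.map (rename π) Γ'
    ⪯-ren {Γ} {Γ'} π i h = ⪯-intro λ p → case (∈-map⁻ (rename π) p)
      where
      case : ∀ {N} → Σ[ M ∈ Msg ] (M ∈ Γ × N ≡ rename π M) → List.map (rename π) Γ' ⊢ N
      case (M , M∈ , refl) = Equivalence.from (⊢-ren π i Γ' M) (h M (⊢-∈ M∈))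

    ≃-refl : ∀ {Γ} → Γ ≃ Γ
    ≃-refl = (λ _ d → d) , (λ _ d → d)

    ≃-⊆ : ∀ {Γ Γ'} → Γ ⊆ Γ' → Γ' ⊆ Γ → Γ ≃ Γ'
    ≃-⊆ s t = (λ _ → ⊢-mono s) , (λ _ → ⊢-mono t)

    map-rename-cong : ∀ {ρ π} Γ → (∀ {a} → a ∈ namesL Γ → π a ≡ ρ a) →
                      List.map (rename π) Γ ≡ List.map (rename ρ) Γ
    map-rename-cong []      h = refl
    map-rename-cong (M ∷ Γ) h =
      cong₂ _∷_ (rename-ext M (h ∘ ∈-++⁺ˡ)) (map-rename-cong Γ (h ∘ ∈-++⁺ʳ (names M)))

    -- `⊢-ren` needs a globally injective renaming, whereas the environments of openings are
    -- injective only on a finite set; `extend` bridges the gap.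
    ⪯-renOn : ∀ {Γ Γ'} ρ → InjOn (namesL Γ ++ namesL Γ') ρ → Γ ⪯ Γ' →
              List.map (rename ρ) Γ ⪯ List.map (rename ρ) Γ'
    ⪯-renOn {Γ} {Γ'} ρ i h =
      let π , πi , agree = extend (namesL Γ ++ namesL Γ') ρ i
      in subst₂ _⪯_ (map-rename-cong Γ (agree ∘ ∈-++⁺ˡ)) (map-rename-cong Γ' (agree ∘ ∈-++⁺ʳ (namesL Γ)))
           (⪯-ren π πi h)

    -- Messages and calls of opened processes

    infix 4 _~_
    -- There is no α-rule and no rule for `ν`. This is what lets messages and calls be compared
    -- separately, by `msgs-~` and `calls-~`.
    data _~_ : Proc → Proc → Set where
      ~-refl  : ∀ {P} → P ~ P
      ~-sym   : ∀ {P Q} → P ~ Q → Q ~ P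
      ~-trans : ∀ {P Q R} → P ~ Q → Q ~ R → P ~ R
      ~-∥     : ∀ {P P' Q Q'} → P ~ P' → Q ~ Q' → P ∥ Q ~ P' ∥ Q'
      ~-assoc : ∀ {P Q R} → (P ∥ Q) ∥ R ~ P ∥ (Q ∥ R)
      ~-comm  : ∀ {P Q} → P ∥ Q ~ Q ∥ P
      ~-unit  : ∀ {P} → P ∥ 𝟘 ~ P
      ~-know  : ∀ {Γ Γ'} → Γ ≃ Γ' → ⟨ Γ ⟩ ~ ⟨ Γ' ⟩

    ~⇒≅ : ∀ {P Q} → P ~ Q → P ≅ Q
    ~⇒≅ ~-refl        = ≅-refl
    ~⇒≅ (~-sym p)     = ≅-sym (~⇒≅ p)
    ~⇒≅ (~-trans p q) = ≅-trans (~⇒≅ p) (~⇒≅ q)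
    ~⇒≅ (~-∥ p q)     = ≅-∥ (~⇒≅ p) (~⇒≅ q)
    ~⇒≅ ~-assoc       = ≅-≡ ≡-assoc
    ~⇒≅ ~-comm        = ≅-≡ ≡-comm
    ~⇒≅ ~-unit        = ≅-≡ ≡-unit
    ~⇒≅ (~-know e)    = ≅-know e

    msgs : Proc → List Msg
    msgs ⟪ M ⟫      = M ∷ []
    msgs (P ∥ Q)    = msgs P ++ msgs Q
    msgs 𝟘          = []
    msgs (ν _ _)    = []
    msgs (call _ _) = []

    -- A restricted process counts as a call, so that `msgs-calls` holds for every process and no
    -- flatness has to be carried along.
    calls : Proc → Proc
    calls ⟪ M ⟫       = 𝟘
    calls (P ∥ Q)     = calls P ∥ calls Q
    calls 𝟘           = 𝟘
    calls (ν x P)     = ν x P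
    calls (call q Ms) = call q Ms

    ≡-unitˡ : ∀ {P} → (𝟘 ∥ P) ≡ₛ P
    ≡-unitˡ = ≡-trans ≡-comm ≡-unit

    ⟨⟩-++ : ∀ Γ Γ' → ⟨ Γ ++ Γ' ⟩ ≡ₛ (⟨ Γ ⟩ ∥ ⟨ Γ' ⟩)
    ⟨⟩-++ []      Γ' = ≡-sym ≡-unitˡ
    ⟨⟩-++ (M ∷ Γ) Γ' = ≡-trans (≡-∥ ≡-refl (⟨⟩-++ Γ Γ')) (≡-sym ≡-assoc)

    ∥-interchange : ∀ {P Q R S} → ((P ∥ Q) ∥ (R ∥ S)) ≡ₛ ((P ∥ R) ∥ (Q ∥ S))
    ∥-interchange = ≡-trans ≡-assoc (≡-trans (≡-∥ ≡-refl ∥-swap) (≡-sym ≡-assoc))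

    msgs-calls : ∀ P → P ≡ₛ (⟨ msgs P ⟩ ∥ calls P)
    msgs-calls 𝟘          = ≡-sym ≡-unit
    msgs-calls (ν x P)    = ≡-sym ≡-unitˡ
    msgs-calls (call _ _) = ≡-sym ≡-unitˡ
    msgs-calls ⟪ M ⟫      = ≡-sym (≡-trans ≡-unit ≡-unit)
    msgs-calls (P ∥ Q)    = ≡-trans (≡-∥ (msgs-calls P) (msgs-calls Q))
      (≡-trans ∥-interchange (≡-∥ (≡-sym (⟨⟩-++ (msgs P) (msgs Q))) ≡-refl))

    msgs-⟨⟩ : ∀ Γ → msgs ⟨ Γ ⟩ ≡ Γ
    msgs-⟨⟩ []      = refl
    msgs-⟨⟩ (M ∷ Γ) = cong (M ∷_) (msgs-⟨⟩ Γ)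

    calls-⟨⟩ : ∀ Γ → calls ⟨ Γ ⟩ ≡ₛ 𝟘
    calls-⟨⟩ []      = ≡-refl
    calls-⟨⟩ (M ∷ Γ) = ≡-trans ≡-unitˡ (calls-⟨⟩ Γ)

    -- Knowledge rules relate processes without calls, so they vanish here. The result is `≡ₛ` and
    -- not merely `≅`, as the definition of `⊑` demands.
    calls-~ : ∀ {P Q} → P ~ Q → calls P ≡ₛ calls Q
    calls-~ ~-refl        = ≡-refl
    calls-~ (~-sym p)     = ≡-sym (calls-~ p)
    calls-~ (~-trans p q) = ≡-trans (calls-~ p) (calls-~ q)
    calls-~ (~-∥ p q)     = ≡-∥ (calls-~ p) (calls-~ q)
    calls-~ ~-assoc       = ≡-assoc
    calls-~ ~-comm        = ≡-comm
    calls-~ ~-unit        = ≡-unit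
    calls-~ (~-know {Γ} {Γ'} _) = ≡-trans (calls-⟨⟩ Γ) (≡-sym (calls-⟨⟩ Γ'))

    msgs-~ : ∀ {P Q} → P ~ Q → msgs P ≃ msgs Q
    msgs-~ ~-refl        = ≃-refl
    msgs-~ (~-sym p)     = let h , h' = msgs-~ p in h' , h
    msgs-~ (~-trans p q) = let f , f' = msgs-~ p
                               g , g' = msgs-~ q
                           in (λ M → g M ∘ f M) , (λ M → f' M ∘ g' M)
    msgs-~ (~-∥ p q)     = let f , f' = msgs-~ p
                               g , g' = msgs-~ q
                           in ⪯-++ f g , ⪯-++ f' g'
    msgs-~ (~-assoc {P} {Q} {R}) = subst (_≃ (msgs P ++ msgs Q ++ msgs R))
      (sym (++-assoc (msgs P) (msgs Q) (msgs R))) ≃-refl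
    msgs-~ (~-comm {P} {Q}) = ≃-⊆ (∈-resp-↭ (++-comm (msgs P) (msgs Q))) (∈-resp-↭ (++-comm (msgs Q) (msgs P)))
    msgs-~ (~-unit {P}) = subst (_≃ msgs P) (sym (++-identityʳ (msgs P))) ≃-refl
    msgs-~ (~-know {Γ} {Γ'} e) = subst₂ _≃_ (sym (msgs-⟨⟩ Γ)) (sym (msgs-⟨⟩ Γ')) e

    -- Openings of P are openings of Q once the pool is enlarged by #fresh names;
    -- scope lists the names on which the environment must be injective.
    record Transfer (P Q : Proc) : Set where
      field
        #fresh : ℕ
        scope  : List Name
        move   : ∀ {ρ zs T} js → length js ≡ #fresh → Good ρ scope (js ++ zs) → Open ρ P zs T →
                 Σ[ U ∈ Proc ] (Open ρ Q (js ++ zs) U × T ~ U)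

    open Transfer

    direct : ∀ {P Q} → (∀ {ρ zs T} → Open ρ P zs T → Σ[ U ∈ Proc ] (Open ρ Q zs U × T ~ U)) → Transfer P Q
    direct f .#fresh = 0
    direct f .scope  = []
    direct f .move [] _ _ o = f o

    rearrange : ∀ {P Q} → (∀ {ρ zs T} → Open ρ P zs T → Open ρ Q zs T) → Transfer P Q
    rearrange f = direct λ o → _ , f o , ~-refl

    transfer-trans : ∀ {P Q R} → Transfer P Q → Transfer Q R → Transfer P R
    transfer-trans t u .#fresh = #fresh u + #fresh t
    transfer-trans t u .scope  = scope t ++ scope u
    transfer-trans t u .move {zs = zs} js l g o with split-length js (#fresh u) l
    ... | js₂ , js₁ , refl , l₂ , l₁ =
      let g'         = subst (Good _ _) (++-assoc js₂ js₁ zs) g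
          U , o₁ , e = t .move js₁ l₁ (good-⊆ ∈-++⁺ˡ (good-++ʳ js₂ g')) o
          V , o₂ , f = u .move js₂ l₂ (good-⊆ (∈-++⁺ʳ (scope t)) g') o₁
      in V , open-↭ (↭-sym (↭-assoc js₂ js₁ zs)) o₂ , ~-trans e f

    transfer-ν : ∀ {x P Q} → Transfer P Q → Transfer (ν x P) (ν x Q)
    transfer-ν t .#fresh = #fresh t
    transfer-ν t .scope  = scope t
    transfer-ν {x} t .move js l g (o-ν {ws = ws} z p o) =
      let q         = ↭-trans (++⁺ˡ js p) (shift z js ws)
          U , r , e = t .move js l (good-upd x (good-↭ q g)) o
      in U , o-ν z q r , e

    transfer-∥ : ∀ {P P' Q Q'} → Transfer P P' → Transfer Q Q' → Transfer (P ∥ Q) (P' ∥ Q')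
    transfer-∥ t u .#fresh = #fresh t + #fresh u
    transfer-∥ t u .scope  = scope t ++ scope u
    transfer-∥ t u .move {zs = zs} js l g (o-∥ {us = us} {vs} p o r) with split-length js (#fresh t) l
    ... | js₁ , js₂ , refl , l₁ , l₂ =
      let q          = ↭-trans (++⁺ˡ (js₁ ++ js₂) p) (↭-interchange js₁ js₂ us vs)
          g'         = good-↭ q g
          U , o' , e = t .move js₁ l₁ (good-⊆ ∈-++⁺ˡ (good-++ˡ (js₁ ++ us) g')) o
          V , r' , f = u .move js₂ l₂ (good-⊆ (∈-++⁺ʳ (scope t)) (good-++ʳ (js₁ ++ us) g')) r
      in U ∥ V , o-∥ q o' r' , ~-∥ e f

    upd-comm : ∀ (ρ : Name → Name) a b {z w c} → a ≢ b → upd (upd ρ a z) b w c ≡ upd (upd ρ b w) a z c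
    upd-comm ρ a b {z} {w} {c} a≢b with c ≟ a | c ≟ b
    ... | yes refl | yes refl = contradiction refl a≢b
    ... | yes refl | no c≢b = trans (upd-diff (upd ρ a z) b w c≢b) (trans (upd-same ρ a z) (sym (upd-same (upd ρ b w) a z)))
    ... | no c≢a | yes refl = trans (upd-same (upd ρ a z) b w) (sym (trans (upd-diff (upd ρ b w) a z c≢a) (upd-same ρ b w)))
    ... | no c≢a | no c≢b = trans (upd-diff (upd ρ a z) b w c≢b) (trans (upd-diff ρ a z c≢a)
      (sym (trans (upd-diff (upd ρ b w) a z c≢a) (upd-diff ρ b w c≢b))))

    open-νν : ∀ {ρ a b P zs T} → Open ρ (ν a (ν b P)) zs T → Open ρ (ν b (ν a P)) zs T
    open-νν {ρ} {a} {b} (o-ν z p (o-ν {ws = ws} w q o)) with a ≟ b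
    -- Equal binders give the same process on both sides; exchanging `z` and `w` would be wrong
    -- here, since the inner update shadows the outer.
    ... | yes refl = o-ν z p (o-ν w q o)
    ... | no a≢b   = o-ν w (↭-trans p (↭-trans (↭.prep z q) (↭.swap z w ↭-refl)))
                       (o-ν z ↭-refl (open-ext (λ {c} _ → upd-comm ρ a b {z} {w} {c} a≢b) o))

    upd-nonfree : ∀ (ρ : Name → Name) P a z → a ∉ fnP P → ∀ {c} → c ∈ fnP P → ρ c ≡ upd ρ a z c
    upd-nonfree ρ P a z a∉ c∈ = sym (upd-diff ρ a z (λ { refl → a∉ c∈ }))

    -- Congruences act on openings

    mutual
      -- Both directions are proved simultaneously: `≡-sym` exchanges them, and a `Transfer` cannot
      -- be inverted, since it may enlarge the pool.
      ≡-transfer : ∀ {P Q} → P ≡ₛ Q → Transfer P Q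
      ≡-transfer (≡-α p)       = rearrange (open-α p)
      ≡-transfer ≡-refl        = rearrange id
      ≡-transfer (≡-sym p)     = ≡-transfer⁻ p
      ≡-transfer (≡-trans p q) = transfer-trans (≡-transfer p) (≡-transfer q)
      ≡-transfer (≡-ν p)       = transfer-ν (≡-transfer p)
      ≡-transfer (≡-∥ p q)     = transfer-∥ (≡-transfer p) (≡-transfer q)
      ≡-transfer ≡-assoc = direct λ { (o-∥ {vs = ws} p (o-∥ {us = us} {vs} q o₁ o₂) o₃) →
        _ , o-∥ (↭-trans p (↭-trans (++⁺ʳ ws q) (↭-assoc us vs ws))) o₁ (o-∥ ↭-refl o₂ o₃) , ~-assoc }
      ≡-transfer ≡-comm = direct λ { (o-∥ {us = us} {vs} p o r) → _ , o-∥ (↭-trans p (++-comm us vs)) r o , ~-comm }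
      -- The names `vs` allotted to `𝟘` are handed to the remaining component as surplus.
      ≡-transfer ≡-unit = direct λ { (o-∥ {us = us} {vs} p o o-𝟘) →
        _ , open-↭ (↭-sym (↭-trans p (++-comm us vs))) (open-weaken vs o) , ~-unit }
      ≡-transfer ≡-ν𝟘 = rearrange λ { (o-ν _ _ o-𝟘) → o-𝟘 }
      ≡-transfer ≡-νν = rearrange open-νν
      ≡-transfer (≡-extr {a} {P} a∉) = rearrange λ { {ρ} (o-∥ {us = us} {vs} p o (o-ν {ws = ws} z q r)) →
        o-ν z (↭-trans p (↭-trans (++⁺ˡ us q) (shift z us ws)))
          (o-∥ ↭-refl (open-ext (upd-nonfree ρ P a z a∉) o) r) }

      ≡-transfer⁻ : ∀ {P Q} → P ≡ₛ Q → Transfer Q P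
      ≡-transfer⁻ (≡-α p)       = rearrange (open-α (=α-sym p))
      ≡-transfer⁻ ≡-refl        = rearrange id
      ≡-transfer⁻ (≡-sym p)     = ≡-transfer p
      ≡-transfer⁻ (≡-trans p q) = transfer-trans (≡-transfer⁻ q) (≡-transfer⁻ p)
      ≡-transfer⁻ (≡-ν p)       = transfer-ν (≡-transfer⁻ p)
      ≡-transfer⁻ (≡-∥ p q)     = transfer-∥ (≡-transfer⁻ p) (≡-transfer⁻ q)
      ≡-transfer⁻ ≡-assoc = direct λ { (o-∥ {us = us} p o₁ (o-∥ {us = vs} {ws} q o₂ o₃)) →
        _ , o-∥ (↭-trans p (↭-trans (++⁺ˡ us q) (↭-sym (↭-assoc us vs ws)))) (o-∥ ↭-refl o₁ o₂) o₃ , ~-sym ~-assoc }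
      ≡-transfer⁻ ≡-comm = direct λ { (o-∥ {us = us} {vs} p o r) → _ , o-∥ (↭-trans p (++-comm us vs)) r o , ~-comm }
      ≡-transfer⁻ ≡-unit = direct λ {_} {zs} o →
        _ , o-∥ (↭-reflexive (sym (++-identityʳ zs))) o o-𝟘 , ~-sym ~-unit
      -- This is the only rule that consumes a new name; every other count is zero or a sum of
      -- counts.
      ≡-transfer⁻ ≡-ν𝟘 .#fresh = 1
      ≡-transfer⁻ ≡-ν𝟘 .scope  = []
      ≡-transfer⁻ ≡-ν𝟘 .move (j ∷ []) _ _ o-𝟘 = 𝟘 , o-ν j ↭-refl o-𝟘 , ~-refl
      ≡-transfer⁻ ≡-νν = rearrange open-νν
      ≡-transfer⁻ (≡-extr {a} {P} a∉) = rearrange λ { {ρ} (o-ν z p (o-∥ {us = us} {vs} q o r)) →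
        o-∥ (↭-trans p (↭-trans (↭.prep z q) (↭-sym (shift z us vs))))
          (open-ext (sym ∘ upd-nonfree ρ P a z a∉) o) (o-ν z ↭-refl r) }

    -- The only rule that contributes to the scope, since deducibility is preserved only by
    -- injective renamings. The names are listed in both orders to match `⪯-renOn` in its two
    -- directions.
    know-transfer : ∀ {Γ Γ'} → Γ ≃ Γ' → Transfer ⟨ Γ ⟩ ⟨ Γ' ⟩
    know-transfer e .#fresh = 0
    know-transfer {Γ} {Γ'} e .scope = (namesL Γ ++ namesL Γ') ++ (namesL Γ' ++ namesL Γ)
    know-transfer {Γ} {Γ'} (h , h') .move {ρ} [] _ g o =
      ⟨ List.map (rename ρ) Γ' ⟩
      , subst (Open ρ ⟨ Γ' ⟩ _) (renP-⟨⟩ ρ Γ') (open-flat (flat-⟨⟩ Γ'))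
      , subst (_~ _) (sym (trans (open-flat⁻ (flat-⟨⟩ Γ) o) (renP-⟨⟩ ρ Γ)))
          (~-know ( ⪯-renOn {Γ} {Γ'} ρ (inj (good-⊆ ∈-++⁺ˡ g)) h
                  , ⪯-renOn {Γ'} {Γ} ρ (inj (good-⊆ (∈-++⁺ʳ (namesL Γ ++ namesL Γ')) g)) h'))

    mutual
      ≅-transfer : ∀ {P Q} → P ≅ Q → Transfer P Q
      ≅-transfer (≅-≡ p)       = ≡-transfer p
      ≅-transfer (≅-know e)    = know-transfer e
      ≅-transfer ≅-refl        = rearrange id
      ≅-transfer (≅-sym p)     = ≅-transfer⁻ p
      ≅-transfer (≅-trans p q) = transfer-trans (≅-transfer p) (≅-transfer q)
      ≅-transfer (≅-ν p)       = transfer-ν (≅-transfer p)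
      ≅-transfer (≅-∥ p q)     = transfer-∥ (≅-transfer p) (≅-transfer q)

      ≅-transfer⁻ : ∀ {P Q} → P ≅ Q → Transfer Q P
      ≅-transfer⁻ (≅-≡ p)       = ≡-transfer⁻ p
      ≅-transfer⁻ (≅-know (h , h')) = know-transfer (h' , h)
      ≅-transfer⁻ ≅-refl        = rearrange id
      ≅-transfer⁻ (≅-sym p)     = ≅-transfer p
      ≅-transfer⁻ (≅-trans p q) = transfer-trans (≅-transfer⁻ q) (≅-transfer⁻ p)
      ≅-transfer⁻ (≅-ν p)       = transfer-ν (≅-transfer⁻ p)
      ≅-transfer⁻ (≅-∥ p q)     = transfer-∥ (≅-transfer⁻ p) (≅-transfer⁻ q)

    -- Reductions

    renP-nus : ∀ ρ xs P → renP ρ (nus xs P) ≡ nus (List.map ρ xs) (renP ρ P)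
    renP-nus ρ []       P = refl
    renP-nus ρ (x ∷ xs) P = cong (ν (ρ x)) (renP-nus ρ xs P)

    renP-names : ∀ ρ ys → renP ρ ⟨ List.map name ys ⟩ ≡ ⟨ List.map name (List.map ρ ys) ⟩
    renP-names ρ []       = refl
    renP-names ρ (y ∷ ys) = cong (⟪ name (ρ y) ⟫ ∥_) (renP-names ρ ys)

    map-rename-names : ∀ ρ ys → List.map (rename ρ) (List.map name ys) ≡ List.map name (List.map ρ ys)
    map-rename-names ρ []       = refl
    map-rename-names ρ (y ∷ ys) = cong (name (ρ y) ∷_) (map-rename-names ρ ys)

    -- Closedness of the body confines its free names to the parameters, where the two substitutions
    -- differ exactly by `π`; hence the same definition yields the renamed instance.
    ≜-ren : ∀ {q Ms A} π → Injective _≡_ _≡_ π → q [ Ms ]≜ A → q [ renameV π Ms ]≜ renA π A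
    ≜-ren {Ms = Ms} π i (d , e , A₀ , A₁ , α , s , eq) =
      let A₀' , A₁' , α' , s' , β = substA-ren {σ' = zipσ (Def.params d) (renameV π Ms)} π i α s
            (λ p → look-zip-ren π (Def.params d) Ms (Def.body-closed d p))
      in d , e , A₀' , A₁' , α' , s' , ≈-trans (≈A-ren π i eq) (≈-α β)

    renA-⊕? : ∀ π A B → renA π (A ⊕? B) ≡ (renA π A ⊕? Maybe.map (renA π) B)
    renA-⊕? π A nothing  = refl
    renA-⊕? π A (just B) = refl

    ≜-ren-⊕? : ∀ {q Ms A} B π → Injective _≡_ _≡_ π → q [ Ms ]≜ (A ⊕? B) →
               q [ renameV π Ms ]≜ (renA π A ⊕? Maybe.map (renA π) B)
    ≜-ren-⊕? {q} {Ms} {A} B π i d = subst (q [ renameV π Ms ]≜_) (renA-⊕? π A B) (≜-ren π i d)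

    -- The reduction axioms without their context: under the knowledge Γ, the calls K
    -- are replaced by Y, with new names ns.
    data Head (Γ : List Msg) : Proc → List Name → Proc → Set where
      h-comm : ∀ {q₁ Ms₁ q₂ Ms₂ c xs N P₁ P₂ P₂' A₁ A₂} (Ms : Vec Msg (length xs)) →
               q₁ [ Ms₁ ]≜ (out c (substM (zipσ (Vec.fromList xs) Ms) N) P₁ ⊕? A₁) →
               q₂ [ Ms₂ ]≜ (inp c xs N P₂ ⊕? A₂) →
               P₂ [ zipσ (Vec.fromList xs) Ms ]≔ P₂' →
               Head Γ (call q₁ Ms₁ ∥ call q₂ Ms₂) [] (P₁ ∥ P₂')
      h-out  : ∀ {q Ms c M P A} → q [ Ms ]≜ (out c M P ⊕? A) → Γ ⊢ name c →
               Head Γ (call q Ms) [] (⟪ M ⟫ ∥ P)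
      h-in   : ∀ {q Ms₀ c xs N P P' A} ys (Ms : Vec Msg (length xs)) →
               q [ Ms₀ ]≜ (inp c xs N P ⊕? A) → Γ ⊢ name c → Unique ys →
               (Γ ++ List.map name ys) ⊢ substM (zipσ (Vec.fromList xs) Ms) N →
               P [ zipσ (Vec.fromList xs) Ms ]≔ P' →
               Head Γ (call q Ms₀) ys (⟨ List.map name ys ⟩ ∥ P')

    head-flat : ∀ {Γ K ns Y} → Head Γ K ns Y → Flat K
    head-flat (h-comm _ _ _ _)       = f-∥ f-call f-call
    head-flat (h-out _ _)            = f-call
    head-flat (h-in _ _ _ _ _ _ _)   = f-call

    head-unique : ∀ {Γ K ns Y} → Head Γ K ns Y → Unique ns
    head-unique (h-comm _ _ _ _)     = []
    head-unique (h-out _ _)          = []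
    head-unique (h-in _ _ _ _ u _ _) = u

    FreshFor : List Name → List Name → Proc → Set
    FreshFor ns as P = All (λ y → y ∉ as × y ∉ fnP P) ns

    head-step : ∀ {as Γ K ns Y C} → Head Γ K ns Y → FreshFor ns as (⟨ Γ ⟩ ∥ K ∥ C) →
                nus as (⟨ Γ ⟩ ∥ K ∥ C) ⟶ nus as (nus ns (⟨ Γ ⟩ ∥ Y ∥ C))
    head-step {as} {Γ} {C = C} (h-comm Ms d₁ d₂ s) fr =
      closure (≅-≡ (nus-cong as (≡-∥ ≡-refl ≡-assoc))) (comm {as = as} {Γ = Γ} {C = C} Ms d₁ d₂ s)
              (≅-≡ (nus-cong as (≡-∥ ≡-refl (≡-sym ≡-assoc))))
    head-step {as} {C = C} (h-out d c) fr =
      closure ≅-refl (pubOut {as = as} {C = C} d c) (≅-≡ (nus-cong as (≡-∥ ≡-refl (≡-sym ≡-assoc))))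
    head-step {as} {C = C} (h-in ys Ms d c u n s) fr =
      closure ≅-refl (pubIn {as = as} {C = C} ys Ms d c u fr n s)
              (≅-≡ (nus-cong as (nus-cong ys (≡-∥ ≡-refl (≡-sym ≡-assoc)))))

    head-ren : ∀ {Γ K ns Y} π → Injective _≡_ _≡_ π → Head Γ K ns Y →
               Σ[ Y' ∈ Proc ] (Head (List.map (rename π) Γ) (renP π K) (List.map π ns) Y' × Y' ≡ₛ renP π Y)
    head-ren π i (h-comm {xs = xs} {N} {P₁} {A₁ = A₁} {A₂} Ms d₁ d₂ s) =
      let R , s' , e = ≔-ren π i s (look-args-ren π i xs Ms)
      in renP π P₁ ∥ R
       , h-comm (renArgs π xs Ms)
           (subst (λ M → _ [ _ ]≜ (out _ M _ ⊕? _)) (sym (substM-args-ren π i xs Ms N)) (≜-ren-⊕? A₁ π i d₁))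
           (≜-ren-⊕? A₂ π i d₂) s'
       , ≡-∥ ≡-refl (≡-α e)
    head-ren {Γ} π i (h-out {A = A} d c) =
      _ , h-out (≜-ren-⊕? A π i d) (Equivalence.from (⊢-ren π i Γ _) c) , ≡-refl
    head-ren {Γ} π i (h-in {xs = xs} {N} {A = A} ys Ms d c u n s) =
      let R , s' , e = ≔-ren π i s (look-args-ren π i xs Ms)
      in ⟨ List.map name (List.map π ys) ⟩ ∥ R
       , h-in (List.map π ys) (renArgs π xs Ms) (≜-ren-⊕? A π i d) (Equivalence.from (⊢-ren π i Γ _) c)
           (map⁺ i u)
           (subst₂ _⊢_
             (trans (map-++ (rename π) Γ (List.map name ys)) (cong (List.map (rename π) Γ ++_) (map-rename-names π ys)))
             (sym (substM-args-ren π i xs Ms N))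
             (Equivalence.from (⊢-ren π i (Γ ++ List.map name ys) _) n))
           s'
       , ≡-∥ (subst (⟨ List.map name (List.map π ys) ⟩ ≡ₛ_) (sym (renP-names π ys)) ≡-refl) (≡-α e)

    -- Nested uses of `closure` collapse to one axiom between two congruences, so that a single
    -- transfer is needed on each side.
    record Redex (P Q : Proc) : Set where
      constructor redex
      field
        as   : List Name
        Γ    : List Msg
        K    : Proc
        ns   : List Name
        Y C  : Proc
        from : P ≅ nus as (⟨ Γ ⟩ ∥ K ∥ C)
        head : Head Γ K ns Y
        frsh : FreshFor ns as (⟨ Γ ⟩ ∥ K ∥ C)
        to   : nus as (nus ns (⟨ Γ ⟩ ∥ Y ∥ C)) ≅ Q

    ⟶-redex : ∀ {P Q} → P ⟶ Q → Redex P Q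
    ⟶-redex (comm {as = as} {Γ} Ms d₁ d₂ s) = redex as Γ _ [] _ _
      (≅-≡ (nus-cong as (≡-∥ ≡-refl (≡-sym ≡-assoc)))) (h-comm Ms d₁ d₂ s) []
      (≅-≡ (nus-cong as (≡-∥ ≡-refl ≡-assoc)))
    ⟶-redex (pubOut {as = as} {Γ} d c) = redex as Γ _ [] _ _ ≅-refl (h-out d c) []
      (≅-≡ (nus-cong as (≡-∥ ≡-refl ≡-assoc)))
    ⟶-redex (pubIn {as = as} {Γ} ys Ms d c u fr n s) = redex as Γ _ ys _ _ ≅-refl (h-in ys Ms d c u n s) fr
      (≅-≡ (nus-cong as (nus-cong ys (≡-∥ ≡-refl ≡-assoc))))
    ⟶-redex (closure p r q) with ⟶-redex r
    ... | redex as Γ K ns Y C from head fr to = redex as Γ K ns Y C (≅-trans p from) head fr (≅-trans to q)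

    -- Later updates win, as inner restrictions shadow outer ones.
    rebind : (Name → Name) → List Name → List Name → Name → Name
    rebind ρ (x ∷ xs) (z ∷ zs) = rebind (upd ρ x z) xs zs
    rebind ρ _        _        = ρ

    rebind-∉ : ∀ ρ xs zs {a} → a ∉ xs → rebind ρ xs zs a ≡ ρ a
    rebind-∉ ρ []       zs       a∉ = refl
    rebind-∉ ρ (x ∷ xs) []       a∉ = refl
    rebind-∉ ρ (x ∷ xs) (z ∷ zs) a∉ = trans (rebind-∉ (upd ρ x z) xs zs (a∉ ∘ there)) (upd-diff ρ x z (a∉ ∘ here))

    map-rebind : ∀ ρ xs zs → Unique xs → length zs ≡ length xs → List.map (rebind ρ xs zs) xs ≡ zs
    map-rebind ρ []       []       _        _ = refl
    map-rebind ρ (x ∷ xs) (z ∷ zs) (x∉ ∷ u) l = cong₂ _∷_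
      (trans (rebind-∉ (upd ρ x z) xs zs (λ p → All.lookup x∉ p refl)) (upd-same ρ x z))
      (map-rebind (upd ρ x z) xs zs u (suc-injective l))

    good-rebind : ∀ {ρ L zs} xs ws → length ws ≡ length xs → Good ρ L (ws ++ zs) → Good (rebind ρ xs ws) L zs
    good-rebind []       []       _ g = g
    good-rebind (x ∷ xs) (w ∷ ws) l g = good-rebind xs ws (suc-injective l) (good-upd x g)

    open-nus⁺ : ∀ {ρ P zs T} xs ws → length ws ≡ length xs → Open (rebind ρ xs ws) P zs T → Open ρ (nus xs P) (ws ++ zs) T
    open-nus⁺ []       []       _ o = o
    open-nus⁺ (x ∷ xs) (w ∷ ws) l o = o-ν w ↭-refl (open-nus⁺ xs ws (suc-injective l) o)

    open-nus⁻ : ∀ {ρ P zs T} xs → Open ρ (nus xs P) zs T → Σ[ ws ∈ List Name ] Σ[ us ∈ List Name ]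
                (length ws ≡ length xs × zs ↭ ws ++ us × Open (rebind ρ xs ws) P us T)
    open-nus⁻ []       o           = [] , _ , refl , ↭-refl , o
    open-nus⁻ (x ∷ xs) (o-ν z p o) =
      let ws , us , l , q , r = open-nus⁻ xs o
      in z ∷ ws , us , cong suc l , ↭-trans p (↭.prep z q) , r

    nus-rebind : ∀ {ρ L zs P} xs ws → length ws ≡ length xs → allP (nus xs P) ⊆ L → Good ρ L (ws ++ zs) →
                 renP ρ (nus xs P) ≡ₛ nus ws (renP (rebind ρ xs ws) P)
    nus-rebind []       []       _ s g = ≡-refl
    nus-rebind {P = P} (x ∷ xs) (w ∷ ws) l s g = ≡-trans (≡-α (ν-rebind x (nus xs P) s g))
      (≡-ν (nus-rebind xs ws (suc-injective l) (s ∘ there) (good-upd x g)))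

    ren-apart : ∀ {ρ L P zs z} → allP P ⊆ L → Good ρ L zs → z ∈ zs → z ∉ fnP (renP ρ P)
    ren-apart {ρ} {P = P} s g z∈ p =
      let b , b∈ , e = allP-renP ρ P (fnP⊆allP (renP ρ P) p)
      in apart g (s b∈) (subst (_∈ _) e z∈)

    nus-≅ : ∀ zs {P Q} → P ≅ Q → nus zs P ≅ nus zs Q
    nus-≅ []       p = p
    nus-≅ (z ∷ zs) p = ≅-ν (nus-≅ zs p)

    absorb : ∀ {Γ Γ' R S} → Γ ⪯ Γ' → (⟨ Γ' ⟩ ∥ R ∥ S) ≅ ((⟨ Γ ⟩ ∥ R) ∥ (⟨ Γ' ⟩ ∥ S))
    absorb {Γ} {Γ'} h = ≅-trans
      (≅-∥ (≅-know {Γ₂ = Γ ++ Γ'}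
              ( (λ _ → ⊢-mono (∈-++⁺ʳ Γ))
              , ⪯-intro (λ p → [ (λ q → h _ (⊢-∈ q)) , ⊢-∈ ]′ (∈-++⁻ Γ p)))) ≅-refl)
      (≅-≡ (≡-trans (≡-∥ (⟨⟩-++ Γ Γ') ≡-refl) ∥-interchange))

    head-step-≡ : ∀ {as Γ K ns Y C TΓ TK ns'} → Head Γ K ns Y → TΓ ≡ ⟨ Γ ⟩ → TK ≡ K → ns' ≡ ns →
                  FreshFor ns' as (TΓ ∥ TK ∥ C) → nus as (TΓ ∥ TK ∥ C) ⟶ nus as (nus ns' (TΓ ∥ Y ∥ C))
    head-step-≡ h refl refl refl = head-step h

    allP-nus : ∀ zs {P a} → a ∈ allP P → a ∈ allP (nus zs P)
    allP-nus []       p = p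
    allP-nus (z ∷ zs) p = there (allP-nus zs p)

    allP-nus-∈ : ∀ zs {P a} → a ∈ zs → a ∈ allP (nus zs P)
    allP-nus-∈ (z ∷ zs) (here e)  = here e
    allP-nus-∈ (z ∷ zs) (there p) = there (allP-nus-∈ zs p)

    ∥-assoc₃ : ∀ {P Q R S} → ((P ∥ Q ∥ R) ∥ S) ≡ₛ (P ∥ Q ∥ R ∥ S)
    ∥-assoc₃ = ≡-trans ≡-assoc (≡-∥ ≡-refl ≡-assoc)

    fnP-assoc₃ : ∀ P Q R S {a} → a ∈ fnP (P ∥ Q ∥ R ∥ S) → a ∈ fnP (P ∥ Q ∥ R) ⊎ a ∈ fnP S
    fnP-assoc₃ P Q R S {a} p = ∈-++⁻ (fnP (P ∥ Q ∥ R)) (subst (a ∈_) (sym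
      (trans (++-assoc (fnP P) (fnP Q ++ fnP R) (fnP S)) (cong (fnP P ++_) (++-assoc (fnP Q) (fnP R) (fnP S))))) p)

    -- The simulation argument

    module _ {P P' Q : Proc} (rx : Redex P Q) (xs ys : List Name) (R S : Proc)
             (eP : P ≅ nus xs R) (eP' : P' ≅ nus xs (nus ys (R ∥ S))) where
      open Redex rx

      private
        P₀ = nus as (⟨ Γ ⟩ ∥ K ∥ C)
        Q₀ = nus as (nus ns (⟨ Γ ⟩ ∥ Y ∥ C))

        t₁ : Transfer (nus xs R) P₀
        t₁ = ≅-transfer (≅-trans (≅-sym eP) from)

        t₂ : Transfer Q₀ Q
        t₂ = ≅-transfer to

        PS = nus xs (nus ys (R ∥ S))

        -- These are the names on which the environments below must be injective: the scopes of both
        -- transfers and the names of all processes that get opened or renamed.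
        L = scope t₁ ++ scope t₂ ++ allP PS ++ allP P₀ ++ allP Q₀ ++ allP Q

        ⊆₁ : scope t₁ ⊆ L
        ⊆₁ = ∈-++⁺ˡ
        ⊆₂ : scope t₂ ⊆ L
        ⊆₂ = ∈-++⁺ʳ (scope t₁) ∘ ∈-++⁺ˡ
        ⊆PS : allP PS ⊆ L
        ⊆PS = ∈-++⁺ʳ (scope t₁) ∘ ∈-++⁺ʳ (scope t₂) ∘ ∈-++⁺ˡ
        ⊆P₀ : allP P₀ ⊆ L
        ⊆P₀ = ∈-++⁺ʳ (scope t₁) ∘ ∈-++⁺ʳ (scope t₂) ∘ ∈-++⁺ʳ (allP PS) ∘ ∈-++⁺ˡ
        ⊆Q₀ : allP Q₀ ⊆ L
        ⊆Q₀ = ∈-++⁺ʳ (scope t₁) ∘ ∈-++⁺ʳ (scope t₂) ∘ ∈-++⁺ʳ (allP PS) ∘ ∈-++⁺ʳ (allP P₀) ∘ ∈-++⁺ˡ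
        ⊆Q : allP Q ⊆ L
        ⊆Q = ∈-++⁺ʳ (scope t₁) ∘ ∈-++⁺ʳ (scope t₂) ∘ ∈-++⁺ʳ (allP PS) ∘ ∈-++⁺ʳ (allP P₀) ∘ ∈-++⁺ʳ (allP Q₀)

      -- Six disjoint supplies of fresh names: `js₂` and `js` feed `t₂` and `t₁`, `xs'` replaces
      -- `xs`, `ws` opens `R`, `ns'` replaces the names created by the reduction, and `vs` opens its
      -- result `Y`.
      simulate-with : ∀ js₂ js xs' ws ns' vs →
        length js₂ ≡ #fresh t₂ → length js ≡ #fresh t₁ → length xs' ≡ length xs →
        length ws ≡ #ν R → length ns' ≡ length ns → length vs ≡ #ν Y →
        Good id L (js₂ ++ js ++ xs' ++ ws ++ ns' ++ vs) →
        Σ[ Q' ∈ Proc ] (P' ⟶ Q' × Q ⊑ Q')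
      simulate-with js₂ js xs' ws ns' vs lj₂ lj lxs lws lns lvs gd
        with open-exists {rebind id xs xs'} R ws lws
      ... | TR , oR with t₁ .move js lj (good-⊆ ⊆₁ g₁) (open-nus⁺ xs xs' lxs oR)
        where
        g₁ : Good id L (js ++ xs' ++ ws)
        g₁ = good-++ˡ (js ++ xs' ++ ws) (good-↭ (solve 6 (λ a b c d e f →
          a ⊞ b ⊞ c ⊞ d ⊞ e ⊞ f ⊜ (b ⊞ c ⊞ d) ⊞ (a ⊞ e ⊞ f)) ↭-refl js₂ js xs' ws ns' vs) gd)
      ... | T₀ , oP₀ , TR~T₀ with open-nus⁻ as oP₀
      ... | as' , rest , las , pool↭ , o-∥ {us = uΓ} {uKC} {T = TΓ} p oΓ (o-∥ {us = uK} {uC} {T = TK} {TC} q oK oC)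
        -- `Y` does not occur in the redex, so its restrictions are opened separately, from a supply
        -- that the opening of `P₀` has not touched.
        with open-exists {rebind (rebind id as as') ns ns'} Y vs lvs
      ... | TY , oY = result
        where
        ρ₁ = rebind id xs xs'
        ρ₂ = rebind id as as'
        ρ₃ = rebind ρ₂ ns ns'
        pool  = js ++ xs' ++ ws
        pool₁ = pool ++ ns' ++ vs
        ys'   = List.map ρ₁ ys
        S'    = renP ρ₁ S
        X     = ⟨ Γ ⟩ ∥ K ∥ C

        gxs : Good id L (xs' ++ (js ++ ws) ++ (ns' ++ vs) ++ js₂)
        gxs = good-↭ (solve 6 (λ a b c d e f →
          a ⊞ b ⊞ c ⊞ d ⊞ e ⊞ f ⊜ c ⊞ ((b ⊞ d) ⊞ (e ⊞ f) ⊞ a)) ↭-refl js₂ js xs' ws ns' vs) gd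

        gρ₁ : Good ρ₁ L ((js ++ ws) ++ (ns' ++ vs) ++ js₂)
        gρ₁ = good-rebind xs xs' lxs gxs

        gpool : Good id L (pool ++ (ns' ++ vs) ++ js₂)
        gpool = good-↭ (solve 6 (λ a b c d e f →
          a ⊞ b ⊞ c ⊞ d ⊞ e ⊞ f ⊜ (b ⊞ c ⊞ d) ⊞ (e ⊞ f) ⊞ a) ↭-refl js₂ js xs' ws ns' vs) gd

        gpool₁ : Good id L (pool₁ ++ js₂)
        gpool₁ = good-↭ (↭-sym (↭-assoc pool (ns' ++ vs) js₂)) gpool

        gρ₃ : Good ρ₃ L (rest ++ vs)
        gρ₃ = good-rebind ns ns' lns (good-rebind as as' las
          (good-↭ (↭-trans (++⁺ʳ (ns' ++ vs) pool↭) (solve 4 (λ a r n v →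
            (a ⊞ r) ⊞ (n ⊞ v) ⊜ a ⊞ n ⊞ r ⊞ v) ↭-refl as' rest ns' vs)) (good-++ˡ pool₁ gpool₁)))

        ⊆X : allP X ⊆ L
        ⊆X = ⊆P₀ ∘ allP-nus as
        ⊆Y : allP Y ⊆ L
        ⊆Y = ⊆Q₀ ∘ allP-nus as ∘ allP-nus ns ∘ ∈-++⁺ʳ (allP ⟨ Γ ⟩) ∘ ∈-++⁺ˡ
        ⊆ns : ns ⊆ L
        ⊆ns = ⊆Q₀ ∘ allP-nus as ∘ allP-nus-∈ ns
        ⊆ys : ys ⊆ L
        ⊆ys = ⊆PS ∘ allP-nus xs ∘ allP-nus-∈ ys
        ⊆R : allP R ⊆ L
        ⊆R = ⊆PS ∘ allP-nus xs ∘ allP-nus ys ∘ ∈-++⁺ˡ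
        ⊆S : allP S ⊆ L
        ⊆S = ⊆PS ∘ allP-nus xs ∘ allP-nus ys ∘ ∈-++⁺ʳ (allP R)

        -- Freshness of `ns` for the redex and its context lets their openings be read in the
        -- environment that also rebinds `ns`, the one used for `Y`.
        ρ₂≗ρ₃ : ∀ {a} → a ∈ fnP X → ρ₂ a ≡ ρ₃ a
        ρ₂≗ρ₃ a∈ = sym (rebind-∉ ρ₂ ns ns' (λ n∈ → proj₂ (All.lookup frsh n∈) a∈))

        oΓ₃ : Open ρ₃ ⟨ Γ ⟩ uΓ TΓ
        oΓ₃ = open-ext (ρ₂≗ρ₃ ∘ ∈-++⁺ˡ) oΓ
        oK₃ : Open ρ₃ K uK TK
        oK₃ = open-ext (ρ₂≗ρ₃ ∘ ∈-++⁺ʳ (fnP ⟨ Γ ⟩) ∘ ∈-++⁺ˡ) oK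
        oC₃ : Open ρ₃ C uC TC
        oC₃ = open-ext (ρ₂≗ρ₃ ∘ ∈-++⁺ʳ (fnP ⟨ Γ ⟩) ∘ ∈-++⁺ʳ (fnP K)) oC

        -- `ρ₃` is injective only on `L`; `head-ren` requires a renaming that is injective
        -- everywhere.
        ext    = extend L ρ₃ (inj gρ₃)
        π      = proj₁ ext
        π-inj  = proj₁ (proj₂ ext)
        π-≗    = proj₂ (proj₂ ext)
        headπ  = head-ren π π-inj head
        Y'     = proj₁ headπ

        TΓ≡ : TΓ ≡ ⟨ List.map (rename π) Γ ⟩
        TΓ≡ = trans (open-flat⁻ (flat-⟨⟩ Γ) oΓ₃)
          (trans (sym (renP-ext ⟨ Γ ⟩ (π-≗ ∘ ⊆X ∘ ∈-++⁺ˡ))) (renP-⟨⟩ π Γ))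

        TK≡ : TK ≡ renP π K
        TK≡ = trans (open-flat⁻ (head-flat head) oK₃)
          (sym (renP-ext K (π-≗ ∘ ⊆X ∘ ∈-++⁺ʳ (allP ⟨ Γ ⟩) ∘ ∈-++⁺ˡ)))

        ns≡ : ns' ≡ List.map π ns
        ns≡ = trans (sym (map-rebind ρ₂ ns ns' (head-unique head) lns))
          (map-cong-local (All.tabulate (sym ∘ π-≗ ∘ ⊆ns)))

        Y'≡ : Y' ≡ₛ nus vs TY
        Y'≡ = ≡-trans (proj₂ (proj₂ headπ)) (subst (_≡ₛ nus vs TY) (sym (renP-ext Y (π-≗ ∘ ⊆Y)))
          (open-sound ⊆Y (good-++ʳ rest gρ₃) oY))

        -- Two reasons combine: `T₀` is an opening over `pool` and so avoids the other supplies, and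
        -- `S'` is an image under `ρ₁`, whose values on `L` avoid them too.
        new-∉ : ∀ {z} → z ∈ ns' ++ vs → z ∉ fnP (TΓ ∥ TK ∥ TC ∥ S')
        new-∉ z∈ p with fnP-assoc₃ TΓ TK TC S' p
        ... | inj₁ r = open-apart ⊆P₀ gpool oP₀ (∈-++⁺ˡ z∈) r
        ... | inj₂ r = ren-apart {P = S} ⊆S gρ₁ (∈-++⁺ʳ (js ++ ws) (∈-++⁺ˡ z∈)) r

        as₁ = xs' ++ ys' ++ js ++ ws

        new-∉-as₁ : ∀ {z} → z ∈ ns' ++ vs → z ∉ as₁
        new-∉-as₁ z∈ p with ∈-++⁻ xs' p
        ... | inj₁ r = unique-disjoint pool (uniq gpool) (∈-++⁺ʳ js (∈-++⁺ˡ r)) (∈-++⁺ˡ z∈)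
        ... | inj₂ p' with ∈-++⁻ ys' p'
        ...   | inj₂ r = unique-disjoint (js ++ ws) (uniq gρ₁) r (∈-++⁺ˡ z∈)
        ...   | inj₁ r with ∈-map⁻ ρ₁ r
        ...     | y , y∈ , refl = apart gρ₁ (⊆ys y∈) (∈-++⁺ʳ (js ++ ws) (∈-++⁺ˡ z∈))

        nus-as₁ : ∀ Z → nus as₁ Z ≡ nus xs' (nus ys' (nus (js ++ ws) Z))
        nus-as₁ Z = trans (nus-++ xs' (ys' ++ js ++ ws) Z) (cong (nus xs') (nus-++ ys' (js ++ ws) Z))

        before : P' ≅ nus as₁ (TΓ ∥ TK ∥ TC ∥ S')
        before = ≅-trans eP' (≅-trans
          (≅-≡ (subst₂ _≡ₛ_ (renP-id PS) (cong (nus xs') (renP-nus ρ₁ ys (R ∥ S))) (nus-rebind xs xs' lxs ⊆PS gxs)))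
          (subst (nus xs' (nus ys' (renP ρ₁ R ∥ S')) ≅_) (sym (nus-as₁ (TΓ ∥ TK ∥ TC ∥ S'))) (nus-≅ xs' (nus-≅ ys' (≅-trans
            -- The surplus `js` becomes idle restrictions here, because `T₀`, unlike `TR`, may use
            -- these names.
            (≅-≡ (≡-trans (≡-∥ (open-sound ⊆R (good-++ˡ (js ++ ws) gρ₁) (open-weaken js oR)) ≡-refl)
                          (nus-extrˡ (js ++ ws) (λ z∈ → ren-apart {P = S} ⊆S gρ₁ (∈-++⁺ˡ z∈)))))
            (nus-≅ (js ++ ws) (≅-trans (≅-∥ (~⇒≅ TR~T₀) ≅-refl) (≅-≡ ∥-assoc₃))))))))

        step : nus as₁ (TΓ ∥ TK ∥ TC ∥ S') ⟶ nus as₁ (nus ns' (TΓ ∥ Y' ∥ TC ∥ S'))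
        step = head-step-≡ {as = as₁} (proj₁ (proj₂ headπ)) TΓ≡ TK≡ ns≡
          (All.tabulate λ z∈ → new-∉-as₁ (∈-++⁺ˡ z∈) , new-∉ (∈-++⁺ˡ z∈))

        T₁ = TΓ ∥ TY ∥ TC

        oQ₀ : Open id Q₀ pool₁ T₁
        -- The redex `K` is gone; its share `uK` of the pool is kept as surplus, so that the pool is
        -- still all of `pool₁`.
        oQ₀ = open-↭ (↭-sym perm) (open-nus⁺ as as' las (open-nus⁺ ns ns' lns
          (open-weaken uK (o-∥ {us = uΓ} ↭-refl oΓ₃ (o-∥ {us = vs} ↭-refl oY oC₃)))))
          where
          perm : pool₁ ↭ as' ++ ns' ++ uK ++ uΓ ++ vs ++ uC
          perm = ↭-trans (++⁺ʳ (ns' ++ vs) (↭-trans pool↭ (++⁺ˡ as' (↭-trans p (++⁺ˡ uΓ q)))))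
            (solve 6 (λ a u k c n v → (a ⊞ u ⊞ k ⊞ c) ⊞ n ⊞ v ⊜ a ⊞ n ⊞ k ⊞ u ⊞ v ⊞ c)
              ↭-refl as' uΓ uK uC ns' vs)

        moved = t₂ .move js₂ lj₂ (good-⊆ ⊆₂ (good-↭ (++-comm pool₁ js₂) gpool₁)) oQ₀
        TQ    = proj₁ moved
        T₁~TQ = proj₂ (proj₂ moved)

        Q≡ : Q ≡ₛ nus (js₂ ++ pool₁) (⟨ msgs TQ ⟩ ∥ calls TQ)
        Q≡ = ≡-trans (subst (_≡ₛ nus (js₂ ++ pool₁) TQ) (renP-id Q)
            (open-sound ⊆Q (good-↭ (++-comm pool₁ js₂) gpool₁) (proj₁ (proj₂ moved))))
          (nus-cong (js₂ ++ pool₁) (msgs-calls TQ))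

        residue : (TΓ ∥ Y' ∥ TC ∥ S') ≡ₛ nus vs (T₁ ∥ S')
        residue = ≡-trans (≡-∥ ≡-refl (≡-∥ Y'≡ ≡-refl)) (≡-trans ∥-swap
          (≡-trans (nus-extrˡ vs (λ z∈ p → new-∉ (∈-++⁺ʳ ns' z∈) (widen p)))
                   (nus-cong vs (≡-trans ∥-swap (≡-sym ∥-assoc₃)))))
          where
          widen : ∀ {z} → z ∈ fnP (TΓ ∥ TC ∥ S') → z ∈ fnP (TΓ ∥ TK ∥ TC ∥ S')
          widen p = [ ∈-++⁺ˡ , ∈-++⁺ʳ (fnP TΓ) ∘ ∈-++⁺ʳ (fnP TK) ]′ (∈-++⁻ (fnP TΓ) p)

        -- `⊑` requires the same outer restrictions and literally the same shared component as in
        -- `Q≡`. Hence `js₂` is added although idle, and `calls T₁` is exchanged for the congruent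
        -- `calls TQ`; the knowledge may remain `msgs T₁`, which derives whatever `msgs TQ` does.
        Q' = nus (js₂ ++ pool₁) (nus ys' (⟨ msgs T₁ ⟩ ∥ calls TQ ∥ S'))

        js₂-∉ : ∀ {z} → z ∈ js₂ → z ∉ fnP (T₁ ∥ S')
        js₂-∉ z∈ p with ∈-++⁻ (fnP T₁) p
        ... | inj₁ r = open-apart ⊆Q₀ gpool₁ oQ₀ z∈ r
        ... | inj₂ r = ren-apart {P = S} ⊆S gρ₁ (∈-++⁺ʳ (js ++ ws) (∈-++⁺ʳ (ns' ++ vs) z∈)) r

        -- The names `ys'`, private to the larger process, must come innermost to fit the shape of
        -- `⊑`.
        nus-regroup : ∀ Z → nus as₁ (nus ns' (nus vs Z)) ≡ₛ nus pool₁ (nus ys' Z)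
        nus-regroup Z = subst₂ _≡ₛ_
          (trans (nus-++ as₁ (ns' ++ vs) Z) (cong (nus as₁) (nus-++ ns' vs Z))) (nus-++ pool₁ ys' Z)
          (nus-↭ (solve 6 (λ x y j w n v → (x ⊞ y ⊞ j ⊞ w) ⊞ n ⊞ v ⊜ ((j ⊞ x ⊞ w) ⊞ n ⊞ v) ⊞ y)
            ↭-refl xs' ys' js ws ns' vs))

        after : nus as₁ (nus ns' (TΓ ∥ Y' ∥ TC ∥ S')) ≡ₛ Q'
        after = ≡-trans (nus-cong as₁ (nus-cong ns' residue)) (≡-trans (nus-regroup (T₁ ∥ S'))
          (≡-trans (nus-junk js₂ (λ z∈ → js₂-∉ z∈ ∘ fnP-nus ys' (T₁ ∥ S') ∘ fnP-nus pool₁ (nus ys' (T₁ ∥ S'))))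
          (subst (_≡ₛ Q') (nus-++ js₂ pool₁ (nus ys' (T₁ ∥ S')))
            (nus-cong (js₂ ++ pool₁) (nus-cong ys' (≡-trans (≡-∥ (msgs-calls T₁) ≡-refl)
              (≡-trans ≡-assoc (≡-∥ ≡-refl (≡-∥ (calls-~ T₁~TQ) ≡-refl)))))))))

        result : Σ[ Q' ∈ Proc ] (P' ⟶ Q' × Q ⊑ Q')
        result = Q' , closure before step (≅-≡ after)
          , js₂ ++ pool₁ , ys' , msgs TQ , msgs T₁ , calls TQ , S' , Q≡ , ≡-refl , proj₂ (msgs-~ T₁~TQ)

      simulate : Σ[ Q' ∈ Proc ] (P' ⟶ Q' × Q ⊑ Q')
      simulate =
        let l₁ = #fresh t₂ ; l₂ = #fresh t₁ ; l₃ = length xs ; l₄ = #ν R ; l₅ = length ns ; l₆ = #ν Y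
            total = l₁ + (l₂ + (l₃ + (l₄ + (l₅ + l₆))))
            -- A block starting at `bound L` lies above all of `L`, which makes `id` a good
            -- environment; the six supplies are consecutive pieces of it.
            js₂ , r₁ , e₁ , k₁ , m₁ = split-length (block (bound L) total) l₁ (length-block (bound L) total)
            js  , r₂ , e₂ , k₂ , m₂ = split-length r₁ l₂ m₁
            xs' , r₃ , e₃ , k₃ , m₃ = split-length r₂ l₃ m₂
            ws  , r₄ , e₄ , k₄ , m₄ = split-length r₃ l₄ m₃
            ns' , vs , e₅ , k₅ , m₅ = split-length r₄ l₅ m₄
            whole = trans e₁ (cong (js₂ ++_) (trans e₂ (cong (js ++_) (trans e₃ (cong (xs' ++_)
                      (trans e₄ (cong (ws ++_) e₅)))))))
        in simulate-with js₂ js xs' ws ns' vs k₁ k₂ k₃ k₄ k₅ m₅ (subst (Good id L) whole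
             (good (λ _ _ e → e) (λ a∈ → ∉-block total (∈⇒<bound a∈)) (block-unique (bound L) total)))

    ⊑-simulation : ∀ {P P' Q} → P ⟶ Q → P ⊑ P' → Σ[ Q' ∈ Proc ] (P' ⟶ Q' × Q ⊑ Q')
    ⊑-simulation r (xs , ys , Γ₁ , Γ₂ , R , S , eP , eP' , h) =
      simulate (⟶-redex r) xs ys (⟨ Γ₁ ⟩ ∥ R) (⟨ Γ₂ ⟩ ∥ S) (≅-≡ eP)
        (≅-trans (≅-≡ eP') (nus-≅ xs (nus-≅ ys (absorb h))))

theorem8 : (k : ℕ) (ar : Fin k → ℕ) (IM : Syntax.IntruderModel k ar)
           (nq : ℕ) (qar : Fin nq → ℕ) (Δ : Syntax.Processes.Definitions k ar nq qar) →
           let open Syntax k ar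
               open Processes nq qar
               open Semantics IM Δ
           in (P P' Q : Proc) → P ⟶ Q → P ⊑ P' → Σ[ Q' ∈ Proc ] (P' ⟶ Q' × Q ⊑ Q')
theorem8 k ar IM nq qar Δ P P' Q = Calculus.⊑-simulation k ar nq qar IM Δ
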